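{- Let $n\ge 3$ and let $\mathcal{F}$ be a family of subsets of $[n]$. Assume that there are no 6 different sets $A,B_1,B_2,B_3,B_4,C\in\mathcal{F}$ such that $A\subset B_i\subset C$ for all $1\le i\le 4$ and $|B_1|=|B_2|=|B_3|=|B_4|$. Then $|\mathcal{F}|\le\Sigma(n,4)$. Moreover, this bound is best possible: there is a family of subsets of $[n]$ of size $\Sigma(n,4)$ (namely all subsets of $[n]$ lying in the 4 middle levels) containing no such configuration.
   Context: $[n]=\{1,2,\dots,n\}$. For integers $n,k$, $\Sigma(n,k)=\sum_{i=\lceil\frac{n-k}{2}\rceil}^{\lceil\frac{n+k}{2}\rceil-1}\binom{n}{i}$ denotes the sum of the $k$ largest binomial coefficients $\binom{n}{i}$, i.e. the number of subsets of $[n]$ in the $k$ middle levels. -}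

module Defs where

open import Data.Nat using (ℕ; zero; suc; _+_; _∸_; ⌈_/2⌉)
open import Data.Nat.Combinatorics using (_C_)
open import Data.List using (List; map; upTo; length)
open import Data.Nat.ListAction using (sum)
open import Data.List.Relation.Unary.Unique.Propositional using (Unique)
open import Data.List.Membership.Propositional using (_∈_)
open import Data.Fin.Subset using (Subset; _⊂_; ∣_∣)
open import Data.Product using (Σ-syntax; _×_)
open import Relation.Binary.PropositionalEquality using (_≡_)
open import Relation.Nullary using (¬_)

sumRange : ℕ → ℕ → (ℕ → ℕ) → ℕ
sumRange lo hi f = sum (map (λ j → f (lo + j)) (upTo (hi ∸ lo)))

-- Σ(n,k) = sum_{i=⌈(n-k)/2⌉}^{⌈(n+k)/2⌉-1} C(n,i).
-- For n < k the lower limit ⌈(n-k)/2⌉ ≤ 0 and binomials with negative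
-- index vanish, so truncated subtraction n ∸ k gives the same value.
Σ : ℕ → ℕ → ℕ
Σ n k = sumRange ⌈ (n ∸ k) /2⌉ ⌈ (n + k) /2⌉ (λ i → n C i)

-- A family of subsets of [n]: a duplicate-free list of subsets; |F| = length.
Family : ℕ → Set
Family n = List (Subset n)

-- The forbidden configuration: six different sets A, B1..B4, C in F with
-- A ⊂ Bi ⊂ C (strict) and |B1| = |B2| = |B3| = |B4|.
-- (Strict inclusions already force A, C distinct from all Bi and A ≠ C;
-- distinctness of the Bi is required explicitly.)
Config : {n : ℕ} → Family n → Set
Config {n} F =
  Σ[ A ∈ Subset n ] Σ[ B₁ ∈ Subset n ] Σ[ B₂ ∈ Subset n ]
  Σ[ B₃ ∈ Subset n ] Σ[ B₄ ∈ Subset n ] Σ[ C ∈ Subset n ]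
    (A ∈ F × B₁ ∈ F × B₂ ∈ F × B₃ ∈ F × B₄ ∈ F × C ∈ F)
  × (A ⊂ B₁ × A ⊂ B₂ × A ⊂ B₃ × A ⊂ B₄)
  × (B₁ ⊂ C × B₂ ⊂ C × B₃ ⊂ C × B₄ ⊂ C)
  × (∣ B₁ ∣ ≡ ∣ B₂ ∣ × ∣ B₁ ∣ ≡ ∣ B₃ ∣ × ∣ B₁ ∣ ≡ ∣ B₄ ∣)
  × (¬ B₁ ≡ B₂ × ¬ B₁ ≡ B₃ × ¬ B₁ ≡ B₄
     × ¬ B₂ ≡ B₃ × ¬ B₂ ≡ B₄ × ¬ B₃ ≡ B₄)

InMiddleLevels : (n k : ℕ) → Subset n → Set
InMiddleLevels n k S = ⌈ (n ∸ k) /2⌉ Data.Nat.≤ ∣ S ∣ × ∣ S ∣ Data.Nat.< ⌈ (n + k) /2⌉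

{-# OPTIONS --safe #-}
module Submission where

-- Group the maximal chains of the Boolean lattice that meet F by the lowest and highest members A ⊆ C of F on
-- them.  Within [A, C], of rank d, every proper level holds at most 3 members of F, so such a chain
-- meets F on average at most 2 + Σ_{0<j<d} 3 / (d choose j) ≤ 4 times.  This is the LYM-type inequality
-- Σ_{B ∈ F} 1 / (n choose ∣B∣) ≤ 4, here multiplied by n!, and it bounds ∣F∣ by four largest levels.
-- Conversely, four sets of equal size strictly between A and C within four consecutive levels either all cover A
-- or are all covered by C, while an interval of rank at most 3 has at most 3 atoms and 3 coatoms.

open import Defs
open import Data.Nat using (ℕ; _≤_)
open import Data.List using (length)
open import Data.List.Relation.Unary.Unique.Propositional using (Unique)
open import Data.List.Relation.Unary.All using (All)
open import Data.List.Membership.Propositional using (_∈_)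
open import Data.Fin.Subset using (Subset)
open import Data.Product using (Σ-syntax; _×_)
open import Relation.Binary.PropositionalEquality using (_≡_)
open import Relation.Nullary using (¬_)

open import Data.Nat using (⌈_/2⌉; ⌊_/2⌋; zero; suc; _+_; _*_; _∸_; _!; _<_; z≤n; s≤s; pred)
open import Data.Nat.Properties
open import Data.Nat.Combinatorics
  using (k![n∸k]!∣n!; nCk+nC[k+1]≡[n+1]C[k+1]; nCk≡n!/k![n-k]!)
  renaming (_C_ to _choose_)
open import Data.Nat.DivMod using (m/n*n≡m)
open import Data.Nat.ListAction using (sum)
open import Data.Nat.ListAction.Properties using (sum-++)
open import Data.Nat.Tactic.RingSolver using (solve-∀)
import Data.Bool.Properties as Bool
open import Data.Empty using (⊥-elim)
open import Data.Fin.Subset using (inside; outside; ∣_∣; _⊆_; _⊂_; ∁; ⊥)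
open import Data.Fin.Subset.Properties
  using ( _⊆?_; ⊆-antisym; ⊆-reflexive; ⊆-trans; ⊥⊆; drop-∷-⊆; out⊂in; out⊆; s⊂s; s⊆s
        ; p⊆q⇒∁p⊇∁q; p⊆q⇒∣p∣≤∣q∣; p⊂q⇒∣p∣<∣q∣; ∁p⊆∁q⇒p⊇q; ∣p∣≤n; ∣∁p∣≡n∸∣p∣; ∣⊥∣≡0 )
open import Data.List using (List; []; _∷_; _++_; map; filter; upTo; applyUpTo; concat)
open import Data.List.Properties using (map-++; map-∘; length-map; length-++; length-applyUpTo; upTo-∷ʳ)
open import Data.List.Membership.Propositional.Properties
  using ( ∈-++⁺ˡ; ∈-++⁺ʳ; ∈-++⁻; ∈-applyUpTo⁻; ∈-concat⁺′; ∈-concat⁻′; ∈-filter⁺; ∈-filter⁻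
        ; ∈-map⁺; ∈-map⁻; ∈-upTo⁺; ∈-upTo⁻; ∈-∃++ )
import Data.List.Membership.DecPropositional as DecMembership
open import Data.List.Relation.Unary.All as All using ([]; _∷_)
open import Data.List.Relation.Unary.Any using (here; there)
open import Data.List.Relation.Unary.AllPairs using ([]; _∷_)
import Data.List.Relation.Unary.AllPairs.Properties as AllPairs
import Data.List.Relation.Unary.All.Properties as All
import Data.List.Relation.Unary.Unique.Propositional.Properties as Unique
open import Data.Product using (_,_; proj₁; proj₂; ∃)
open import Data.Sum using (_⊎_; inj₁; inj₂)
open import Data.Vec using ([]; _∷_; here)
open import Data.Vec.Properties using (≡-dec; ∷-injectiveʳ)
open import Function using (_∘_; case_of_)
open import Relation.Binary.Definitions using (DecidableEquality)
open import Relation.Binary.PropositionalEquality using (refl; sym; trans; cong; cong₂; subst; subst₂; _≢_; module ≡-Reasoning)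
open import Relation.Nullary using (Dec; yes; no; ¬?; contradiction; _×-dec_)
open import Relation.Unary using (Decidable)

private
  variable
    X Y : Set
    P Q : Set
    n : ℕ
    x y : X
    xs ys : List X
    f g : X → ℕ

-- Finite sums and Iverson brackets

∑ : List X → (X → ℕ) → ℕ
∑ xs f = sum (map f xs)

infix 5 ∑-syntax
∑-syntax = ∑
syntax ∑-syntax xs (λ x → e) = ∑[ x ← xs ] e

∑-cong : (xs : List X) → (∀ {x} → x ∈ xs → f x ≡ g x) → ∑ xs f ≡ ∑ xs g
∑-cong []       eq = refl
∑-cong (x ∷ xs) eq = cong₂ _+_ (eq (here refl)) (∑-cong xs (eq ∘ there))

∑-mono : (xs : List X) → (∀ {x} → x ∈ xs → f x ≤ g x) → ∑ xs f ≤ ∑ xs g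
∑-mono []       le = z≤n
∑-mono (x ∷ xs) le = +-mono-≤ (le (here refl)) (∑-mono xs (le ∘ there))

∑-zero : (xs : List X) → (∀ {x} → x ∈ xs → f x ≡ 0) → ∑ xs f ≡ 0
∑-zero []       eq = refl
∑-zero (x ∷ xs) eq = cong₂ _+_ (eq (here refl)) (∑-zero xs (eq ∘ there))

∑-const : (xs : List X) (c : ℕ) → ∑[ x ← xs ] c ≡ length xs * c
∑-const []       c = refl
∑-const (x ∷ xs) c = cong (c +_) (∑-const xs c)

∑-distrib-+ : (xs : List X) (f g : X → ℕ) → ∑[ x ← xs ] (f x + g x) ≡ ∑ xs f + ∑ xs g
∑-distrib-+ []       f g = refl
∑-distrib-+ (x ∷ xs) f g = begin
  f x + g x + (∑[ x ← xs ] (f x + g x))  ≡⟨ cong (f x + g x +_) (∑-distrib-+ xs f g) ⟩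
  f x + g x + (∑ xs f + ∑ xs g)        ≡⟨ interchange (f x) (g x) (∑ xs f) (∑ xs g) ⟩
  f x + ∑ xs f + (g x + ∑ xs g)        ∎
  where
  open ≡-Reasoning
  interchange : ∀ a b c d → a + b + (c + d) ≡ a + c + (b + d)
  interchange = solve-∀

*-distribˡ-∑ : (c : ℕ) (xs : List X) (f : X → ℕ) → c * ∑ xs f ≡ ∑[ x ← xs ] c * f x
*-distribˡ-∑ c []       f = *-zeroʳ c
*-distribˡ-∑ c (x ∷ xs) f =
  trans (*-distribˡ-+ c (f x) (∑ xs f)) (cong (c * f x +_) (*-distribˡ-∑ c xs f))

*-distribʳ-∑ : (c : ℕ) (xs : List X) (f : X → ℕ) → ∑ xs f * c ≡ ∑[ x ← xs ] f x * c
*-distribʳ-∑ c []       f = refl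
*-distribʳ-∑ c (x ∷ xs) f =
  trans (*-distribʳ-+ c (f x) (∑ xs f)) (cong (f x * c +_) (*-distribʳ-∑ c xs f))

∑-swap : (xs : List X) (ys : List Y) (h : X → Y → ℕ) →
         ∑[ x ← xs ] ∑[ y ← ys ] h x y ≡ ∑[ y ← ys ] ∑[ x ← xs ] h x y
∑-swap []       ys h = sym (∑-zero ys λ _ → refl)
∑-swap (x ∷ xs) ys h = begin
  ∑ ys (h x) + (∑[ x ← xs ] ∑[ y ← ys ] h x y)  ≡⟨ cong (∑ ys (h x) +_) (∑-swap xs ys h) ⟩
  ∑ ys (h x) + (∑[ y ← ys ] ∑[ x ← xs ] h x y)  ≡⟨ ∑-distrib-+ ys (h x) (λ y → ∑[ x ← xs ] h x y) ⟨
  ∑[ y ← ys ] (h x y + (∑[ x ← xs ] h x y))     ∎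
  where open ≡-Reasoning

∑-map : (h : X → Y) (xs : List X) (f : Y → ℕ) → ∑ (map h xs) f ≡ ∑[ x ← xs ] f (h x)
∑-map h xs f = cong sum (sym (map-∘ xs))

∑-++ : (xs ys : List X) (f : X → ℕ) → ∑ (xs ++ ys) f ≡ ∑ xs f + ∑ ys f
∑-++ xs ys f = trans (cong sum (map-++ f xs ys)) (sum-++ (map f xs) (map f ys))

⟦_⟧ : Dec P → ℕ
⟦ yes _ ⟧ = 1
⟦ no  _ ⟧ = 0

⟦⟧-cong : (P → Q) → (Q → P) → (p? : Dec P) (q? : Dec Q) → ⟦ p? ⟧ ≡ ⟦ q? ⟧
⟦⟧-cong to from (yes p) (yes q) = refl
⟦⟧-cong to from (yes p) (no ¬q) = contradiction (to p) ¬q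
⟦⟧-cong to from (no ¬p) (yes q) = contradiction (from q) ¬p
⟦⟧-cong to from (no ¬p) (no ¬q) = refl

⟦⟧-false : ¬ P → (p? : Dec P) → ⟦ p? ⟧ ≡ 0
⟦⟧-false ¬p (yes p) = contradiction p ¬p
⟦⟧-false ¬p (no _)  = refl

⟦⟧-true : P → (p? : Dec P) → ⟦ p? ⟧ ≡ 1
⟦⟧-true p (yes _) = refl
⟦⟧-true p (no ¬p) = contradiction p ¬p

⟦¬⟧+⟦⟧ : (p? : Dec P) → ⟦ ¬? p? ⟧ + ⟦ p? ⟧ ≡ 1
⟦¬⟧+⟦⟧ (yes _) = refl
⟦¬⟧+⟦⟧ (no  _) = refl

∑-filter : {R : X → Set} (R? : Decidable R) (xs : List X) (f : X → ℕ) →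
           ∑ (filter R? xs) f ≡ ∑[ x ← xs ] ⟦ R? x ⟧ * f x
∑-filter R? []       f = refl
∑-filter R? (x ∷ xs) f with R? x
... | yes _ = cong₂ _+_ (sym (*-identityˡ (f x))) (∑-filter R? xs f)
... | no  _ = ∑-filter R? xs f

-- Without repetitions in `xs`, at most one term is nonzero.
∑-select : (_≟_ : DecidableEquality X) (f : X → ℕ) → Unique xs → (y∈?xs : Dec (y ∈ xs)) →
           ∑[ x ← xs ] ⟦ x ≟ y ⟧ * f x ≡ ⟦ y∈?xs ⟧ * f y
∑-select {xs = xs} {y = y} _≟_ f uniq (no y∉xs) =
  ∑-zero xs λ {x} x∈xs → cong (_* f x) (⟦⟧-false (λ { refl → y∉xs x∈xs }) (x ≟ y))
∑-select {xs = x ∷ xs} {y = y} _≟_ f (x∉ ∷ uniq) (yes (here refl)) =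
  trans (cong₂ _+_ (cong (_* f y) (⟦⟧-true refl (y ≟ y)))
                   (∑-zero xs λ {z} z∈xs → cong (_* f z) (⟦⟧-false (λ { refl → All.lookup x∉ z∈xs refl }) (z ≟ y))))
        (+-identityʳ (1 * f y))
∑-select {xs = x ∷ xs} {y = y} _≟_ f (x∉ ∷ uniq) (yes (there y∈xs)) =
  cong₂ _+_ (cong (_* f x) (⟦⟧-false (λ { refl → All.lookup x∉ y∈xs refl }) (x ≟ y)))
            (∑-select _≟_ f uniq (yes y∈xs))

-- Each `x` of nonzero value is matched with one occurrence in `ys`, which is then removed; as `x`
-- does not recur in `xs`, the other entries still find theirs. Entries of value 0 need no match, so
-- a family not contained in `ys` can be compared with it.
∑-⊆ : Unique xs → (∀ {x} → x ∈ xs → f x ≢ 0 → x ∈ ys) → ∑ xs f ≤ ∑ ys f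
∑-⊆ {xs = []} uniq sub = z≤n
∑-⊆ {xs = x ∷ xs} {f = f} {ys = ys} (x∉ ∷ uniq) sub with f x ≟ 0
... | yes fx≡0 = subst (_≤ ∑ ys f) (cong (_+ ∑ xs f) (sym fx≡0)) (∑-⊆ uniq (sub ∘ there))
... | no  fx≢0 with ∈-∃++ (sub (here refl) fx≢0)
...   | as , bs , refl = begin
  f x + ∑ xs f               ≤⟨ +-monoʳ-≤ (f x) (∑-⊆ uniq sub′) ⟩
  f x + ∑ (as ++ bs) f       ≡⟨ cong (f x +_) (∑-++ as bs f) ⟩
  f x + (∑ as f + ∑ bs f)    ≡⟨ shuffle (f x) (∑ as f) (∑ bs f) ⟩
  ∑ as f + ∑ (x ∷ bs) f      ≡⟨ ∑-++ as (x ∷ bs) f ⟨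
  ∑ (as ++ x ∷ bs) f         ∎
  where
  open ≤-Reasoning
  shuffle : ∀ a b c → a + (b + c) ≡ b + (a + c)
  shuffle = solve-∀
  sub′ : ∀ {z} → z ∈ xs → f z ≢ 0 → z ∈ as ++ bs
  sub′ z∈xs fz≢0 with ∈-++⁻ as (sub (there z∈xs) fz≢0)
  ... | inj₁ z∈as         = ∈-++⁺ˡ z∈as
  ... | inj₂ (here refl)  = contradiction refl (All.lookup x∉ z∈xs)
  ... | inj₂ (there z∈bs) = ∈-++⁺ʳ as z∈bs

∑-one : (xs : List X) → ∑[ x ← xs ] 1 ≡ length xs
∑-one xs = trans (∑-const xs 1) (*-identityʳ (length xs))

length-⊆ : Unique xs → (∀ {x} → x ∈ xs → x ∈ ys) → length xs ≤ length ys
length-⊆ {xs = xs} {ys = ys} uniq sub = subst₂ _≤_ (∑-one xs) (∑-one ys) (∑-⊆ uniq (λ x∈xs _ → sub x∈xs))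

-- Subsets and their lower covers

_≟ˢ_ : DecidableEquality (Subset n)
_≟ˢ_ = ≡-dec Bool._≟_

open module SubsetMembership {n} = DecMembership (_≟ˢ_ {n}) using (_∈?_)

⊆⇒≡⊎⊂ : {p q : Subset n} → p ⊆ q → p ≡ q ⊎ p ⊂ q
⊆⇒≡⊎⊂ {p = []}          {[]}          p⊆q = inj₁ refl
⊆⇒≡⊎⊂ {p = outside ∷ p} {inside ∷ q}  p⊆q = inj₂ (out⊂in (drop-∷-⊆ p⊆q))
⊆⇒≡⊎⊂ {p = inside ∷ p}  {outside ∷ q} p⊆q = case p⊆q here of λ ()
⊆⇒≡⊎⊂ {p = outside ∷ p} {outside ∷ q} p⊆q with ⊆⇒≡⊎⊂ (drop-∷-⊆ p⊆q)
... | inj₁ p≡q = inj₁ (cong (outside ∷_) p≡q)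
... | inj₂ p⊂q = inj₂ (s⊂s p⊂q)
⊆⇒≡⊎⊂ {p = inside ∷ p}  {inside ∷ q}  p⊆q with ⊆⇒≡⊎⊂ (drop-∷-⊆ p⊆q)
... | inj₁ p≡q = inj₁ (cong (inside ∷_) p≡q)
... | inj₂ p⊂q = inj₂ (s⊂s p⊂q)

⊆∧∣∣≡⇒≡ : {p q : Subset n} → p ⊆ q → ∣ p ∣ ≡ ∣ q ∣ → p ≡ q
⊆∧∣∣≡⇒≡ p⊆q eq with ⊆⇒≡⊎⊂ p⊆q
... | inj₁ p≡q = p≡q
... | inj₂ p⊂q = contradiction eq (<⇒≢ (p⊂q⇒∣p∣<∣q∣ p⊂q))

⊆∧∣∣<⇒⊂ : {p q : Subset n} → p ⊆ q → ∣ p ∣ < ∣ q ∣ → p ⊂ q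
⊆∧∣∣<⇒⊂ p⊆q lt with ⊆⇒≡⊎⊂ p⊆q
... | inj₁ refl = contradiction refl (<⇒≢ lt)
... | inj₂ p⊂q  = p⊂q

coatoms : Subset n → List (Subset n)
coatoms []            = []
coatoms (inside ∷ p)  = (outside ∷ p) ∷ map (inside ∷_) (coatoms p)
coatoms (outside ∷ p) = map (outside ∷_) (coatoms p)

length-coatoms : (p : Subset n) → length (coatoms p) ≡ ∣ p ∣
length-coatoms []            = refl
length-coatoms (inside ∷ p)  = cong suc (trans (length-map (inside ∷_) (coatoms p)) (length-coatoms p))
length-coatoms (outside ∷ p) = trans (length-map (outside ∷_) (coatoms p)) (length-coatoms p)

∣coatom∣ : {p q : Subset n} → q ∈ coatoms p → suc ∣ q ∣ ≡ ∣ p ∣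
∣coatom∣ {p = inside ∷ p}  (here refl) = refl
∣coatom∣ {p = inside ∷ p}  (there q∈) with ∈-map⁻ (inside ∷_) q∈
... | _ , r∈ , refl = cong suc (∣coatom∣ {p = p} r∈)
∣coatom∣ {p = outside ∷ p} q∈ with ∈-map⁻ (outside ∷_) q∈
... | _ , r∈ , refl = ∣coatom∣ {p = p} r∈

∈-coatoms : {p q : Subset n} → q ⊆ p → suc ∣ q ∣ ≡ ∣ p ∣ → q ∈ coatoms p
∈-coatoms {p = inside ∷ p}  {inside ∷ q}  q⊆p eq = there (∈-map⁺ (inside ∷_) (∈-coatoms (drop-∷-⊆ q⊆p) (suc-injective eq)))
∈-coatoms {p = inside ∷ p}  {outside ∷ q} q⊆p eq = here (cong (outside ∷_) (⊆∧∣∣≡⇒≡ (drop-∷-⊆ q⊆p) (suc-injective eq)))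
∈-coatoms {p = outside ∷ p} {inside ∷ q}  q⊆p eq = case q⊆p here of λ ()
∈-coatoms {p = outside ∷ p} {outside ∷ q} q⊆p eq = ∈-map⁺ (outside ∷_) (∈-coatoms (drop-∷-⊆ q⊆p) eq)

in⊈out : {A B : Subset n} → ¬ (inside ∷ A) ⊆ (outside ∷ B)
in⊈out sub = case sub here of λ ()

⟦out⊆⟧ : (A B : Subset n) (s : _) → ⟦ (outside ∷ A) ⊆? (s ∷ B) ⟧ ≡ ⟦ A ⊆? B ⟧
⟦out⊆⟧ A B s = ⟦⟧-cong drop-∷-⊆ out⊆ ((outside ∷ A) ⊆? (s ∷ B)) (A ⊆? B)

⟦in⊆in⟧ : (A B : Subset n) → ⟦ (inside ∷ A) ⊆? (inside ∷ B) ⟧ ≡ ⟦ A ⊆? B ⟧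
⟦in⊆in⟧ A B = ⟦⟧-cong drop-∷-⊆ s⊆s ((inside ∷ A) ⊆? (inside ∷ B)) (A ⊆? B)

⟦in⊆out⟧ : (A B : Subset n) → ⟦ (inside ∷ A) ⊆? (outside ∷ B) ⟧ ≡ 0
⟦in⊆out⟧ A B = ⟦⟧-false in⊈out ((inside ∷ A) ⊆? (outside ∷ B))

-- A coatom of `B` arises by deleting one element, and it still contains `A` exactly when `A ⊆ B`
-- and the deleted element lies outside `A`. In the induction only the case `outside`, `inside`
-- gains a coatom, the one that deletes the head.
∑-coatoms-⊇ : (A B : Subset n) → ∑[ p ← coatoms B ] ⟦ A ⊆? p ⟧ ≡ ⟦ A ⊆? B ⟧ * (∣ B ∣ ∸ ∣ A ∣)
∑-coatoms-⊇ []            []            = refl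
∑-coatoms-⊇ (inside ∷ A)  (inside ∷ B)  = begin
  ⟦ (inside ∷ A) ⊆? (outside ∷ B) ⟧ + ∑ (map (inside ∷_) (coatoms B)) (λ p → ⟦ (inside ∷ A) ⊆? p ⟧)
    ≡⟨ cong₂ _+_ (⟦in⊆out⟧ A B) (∑-map (inside ∷_) (coatoms B) (λ p → ⟦ (inside ∷ A) ⊆? p ⟧)) ⟩
  ∑[ p ← coatoms B ] ⟦ (inside ∷ A) ⊆? (inside ∷ p) ⟧
    ≡⟨ ∑-cong (coatoms B) (λ {p} _ → ⟦in⊆in⟧ A p) ⟩
  ∑[ p ← coatoms B ] ⟦ A ⊆? p ⟧
    ≡⟨ ∑-coatoms-⊇ A B ⟩
  ⟦ A ⊆? B ⟧ * (∣ B ∣ ∸ ∣ A ∣)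
    ≡⟨ cong (_* (∣ B ∣ ∸ ∣ A ∣)) (⟦in⊆in⟧ A B) ⟨
  ⟦ (inside ∷ A) ⊆? (inside ∷ B) ⟧ * (∣ B ∣ ∸ ∣ A ∣) ∎
  where open ≡-Reasoning
∑-coatoms-⊇ (outside ∷ A) (inside ∷ B)  = begin
  ⟦ (outside ∷ A) ⊆? (outside ∷ B) ⟧ + ∑ (map (inside ∷_) (coatoms B)) (λ p → ⟦ (outside ∷ A) ⊆? p ⟧)
    ≡⟨ cong₂ _+_ (⟦out⊆⟧ A B outside) (∑-map (inside ∷_) (coatoms B) (λ p → ⟦ (outside ∷ A) ⊆? p ⟧)) ⟩
  ⟦ A ⊆? B ⟧ + (∑[ p ← coatoms B ] ⟦ (outside ∷ A) ⊆? (inside ∷ p) ⟧)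
    ≡⟨ cong (⟦ A ⊆? B ⟧ +_) (∑-cong (coatoms B) (λ {p} _ → ⟦out⊆⟧ A p inside)) ⟩
  ⟦ A ⊆? B ⟧ + (∑[ p ← coatoms B ] ⟦ A ⊆? p ⟧)
    ≡⟨ cong (⟦ A ⊆? B ⟧ +_) (∑-coatoms-⊇ A B) ⟩
  ⟦ A ⊆? B ⟧ + ⟦ A ⊆? B ⟧ * (∣ B ∣ ∸ ∣ A ∣)
    ≡⟨ add (A ⊆? B) ⟩
  ⟦ A ⊆? B ⟧ * (suc ∣ B ∣ ∸ ∣ A ∣)
    ≡⟨ cong (_* (suc ∣ B ∣ ∸ ∣ A ∣)) (⟦out⊆⟧ A B inside) ⟨
  ⟦ (outside ∷ A) ⊆? (inside ∷ B) ⟧ * (suc ∣ B ∣ ∸ ∣ A ∣) ∎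
  where
  open ≡-Reasoning
  add : (d : Dec (A ⊆ B)) → ⟦ d ⟧ + ⟦ d ⟧ * (∣ B ∣ ∸ ∣ A ∣) ≡ ⟦ d ⟧ * (suc ∣ B ∣ ∸ ∣ A ∣)
  add (no _)    = refl
  add (yes A⊆B) = begin
    1 + 1 * (∣ B ∣ ∸ ∣ A ∣)  ≡⟨ cong suc (*-identityˡ (∣ B ∣ ∸ ∣ A ∣)) ⟩
    1 + (∣ B ∣ ∸ ∣ A ∣)      ≡⟨ +-∸-assoc 1 (p⊆q⇒∣p∣≤∣q∣ A⊆B) ⟨
    suc ∣ B ∣ ∸ ∣ A ∣        ≡⟨ *-identityˡ (suc ∣ B ∣ ∸ ∣ A ∣) ⟨
    1 * (suc ∣ B ∣ ∸ ∣ A ∣)  ∎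
∑-coatoms-⊇ (inside ∷ A)  (outside ∷ B) = begin
  ∑ (map (outside ∷_) (coatoms B)) (λ p → ⟦ (inside ∷ A) ⊆? p ⟧)
    ≡⟨ ∑-map (outside ∷_) (coatoms B) (λ p → ⟦ (inside ∷ A) ⊆? p ⟧) ⟩
  ∑[ p ← coatoms B ] ⟦ (inside ∷ A) ⊆? (outside ∷ p) ⟧
    ≡⟨ ∑-zero (coatoms B) (λ {p} _ → ⟦in⊆out⟧ A p) ⟩
  0
    ≡⟨ cong (_* (∣ B ∣ ∸ suc ∣ A ∣)) (⟦in⊆out⟧ A B) ⟨
  ⟦ (inside ∷ A) ⊆? (outside ∷ B) ⟧ * (∣ B ∣ ∸ suc ∣ A ∣) ∎
  where open ≡-Reasoning
∑-coatoms-⊇ (outside ∷ A) (outside ∷ B) = begin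
  ∑ (map (outside ∷_) (coatoms B)) (λ p → ⟦ (outside ∷ A) ⊆? p ⟧)
    ≡⟨ ∑-map (outside ∷_) (coatoms B) (λ p → ⟦ (outside ∷ A) ⊆? p ⟧) ⟩
  ∑[ p ← coatoms B ] ⟦ (outside ∷ A) ⊆? (outside ∷ p) ⟧
    ≡⟨ ∑-cong (coatoms B) (λ {p} _ → ⟦out⊆⟧ A p outside) ⟩
  ∑[ p ← coatoms B ] ⟦ A ⊆? p ⟧
    ≡⟨ ∑-coatoms-⊇ A B ⟩
  ⟦ A ⊆? B ⟧ * (∣ B ∣ ∸ ∣ A ∣)
    ≡⟨ cong (_* (∣ B ∣ ∸ ∣ A ∣)) (⟦out⊆⟧ A B outside) ⟨
  ⟦ (outside ∷ A) ⊆? (outside ∷ B) ⟧ * (∣ B ∣ ∸ ∣ A ∣) ∎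
  where open ≡-Reasoning

-- Chains hitting a family for the first time

-- For ∣ p ∣ ≡ k: the number of maximal chains from ∅ to p with no member of F strictly below p.
avoiding : Family n → ℕ → Subset n → ℕ
avoiding F zero    p = 1
avoiding F (suc k) p = ∑[ q ← coatoms p ] ⟦ ¬? (q ∈? F) ⟧ * avoiding F k q

avoiders : Family n → Subset n → ℕ
avoiders F p = avoiding F ∣ p ∣ p

-- Splits off the term A ≡ B; for A ⊂ B one step of the factorial counts the coatoms of B above A.
first-hit-term : (F : Family n) (A B : Subset n) →
  ⟦ A ⊆? B ⟧ * (avoiders F A * (∣ B ∣ ∸ ∣ A ∣) !) ≡
  ⟦ A ≟ˢ B ⟧ * avoiders F A + avoiders F A * ((∑[ p ← coatoms B ] ⟦ A ⊆? p ⟧) * (pred ∣ B ∣ ∸ ∣ A ∣) !)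
first-hit-term F A B = trans (split (A ⊆? B) (A ≟ˢ B))
    (cong (λ c → ⟦ A ≟ˢ B ⟧ * a + a * (c * (pred b ∸ ∣ A ∣) !)) (sym (∑-coatoms-⊇ A B)))
  where
  a = avoiders F A
  b = ∣ B ∣

  !-pred : ∀ m l → l < m → (m ∸ l) ! ≡ (m ∸ l) * (pred m ∸ l) !
  !-pred (suc m) l (s≤s l≤m) rewrite +-∸-assoc 1 l≤m = refl

  split : (d : Dec (A ⊆ B)) (e : Dec (A ≡ B)) →
          ⟦ d ⟧ * (a * (b ∸ ∣ A ∣) !) ≡ ⟦ e ⟧ * a + a * (⟦ d ⟧ * (b ∸ ∣ A ∣) * (pred b ∸ ∣ A ∣) !)
  split (no A⊈B)  (yes refl) = ⊥-elim (A⊈B λ x∈B → x∈B)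
  split (no A⊈B)  (no A≢B)   = sym (*-zeroʳ a)
  -- For `A ≡ B` the factor `b ∸ b` kills the second summand, while `0 !` is 1 on the left.
  split (yes A⊆B) (yes refl) rewrite n∸n≡0 b = identity a
    where
    identity : ∀ m → 1 * (m * 1) ≡ 1 * m + m * 0
    identity = solve-∀
  split (yes A⊆B) (no A≢B) with ⊆⇒≡⊎⊂ A⊆B
  ... | inj₁ A≡B = contradiction A≡B A≢B
  ... | inj₂ A⊂B rewrite !-pred b ∣ A ∣ (p⊂q⇒∣p∣<∣q∣ A⊂B) =
    identity a (b ∸ ∣ A ∣) ((pred b ∸ ∣ A ∣) !)
    where
    identity : ∀ m d k → 1 * (m * (d * k)) ≡ 0 * m + m * (1 * d * k)
    identity = solve-∀

-- Isolates the chains whose lowest member is `B` itself. What remains has the shape that arises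
-- from stepping down to the coatoms of `B`.
first-hit-sum : (F : Family n) → Unique F → ∀ k (B : Subset n) → ∣ B ∣ ≡ k →
  ∑[ A ← F ] ⟦ A ⊆? B ⟧ * (avoiders F A * (k ∸ ∣ A ∣) !) ≡
  ⟦ B ∈? F ⟧ * avoiding F k B +
    (∑[ A ← F ] avoiders F A * ((∑[ p ← coatoms B ] ⟦ A ⊆? p ⟧) * (pred k ∸ ∣ A ∣) !))
first-hit-sum F uniq k B refl = begin
  ∑[ A ← F ] ⟦ A ⊆? B ⟧ * (avoiders F A * (k ∸ ∣ A ∣) !)
    ≡⟨ ∑-cong F (λ {A} _ → first-hit-term F A B) ⟩
  ∑[ A ← F ] (⟦ A ≟ˢ B ⟧ * avoiders F A + rest A)
    ≡⟨ ∑-distrib-+ F (λ A → ⟦ A ≟ˢ B ⟧ * avoiders F A) rest ⟩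
  (∑[ A ← F ] ⟦ A ≟ˢ B ⟧ * avoiders F A) + ∑ F rest
    ≡⟨ cong (_+ ∑ F rest) (∑-select _≟ˢ_ (avoiders F) uniq (B ∈? F)) ⟩
  ⟦ B ∈? F ⟧ * avoiders F B + ∑ F rest ∎
  where
  open ≡-Reasoning
  rest : Subset _ → ℕ
  rest A = avoiders F A * ((∑[ p ← coatoms B ] ⟦ A ⊆? p ⟧) * (pred k ∸ ∣ A ∣) !)

mutual

  -- The `k !` maximal chains from the empty set to `B` are sorted by their lowest member `A` of
  -- `F`: `avoiders F A` ways to reach `A`, then `(k ∸ ∣ A ∣) !` ways to go on to `B`. The first
  -- summand counts the chains that miss `F` altogether.
  first-hit : (F : Family n) → Unique F → ∀ k (B : Subset n) → ∣ B ∣ ≡ k →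
    k ! ≡ ⟦ ¬? (B ∈? F) ⟧ * avoiding F k B + (∑[ A ← F ] ⟦ A ⊆? B ⟧ * (avoiders F A * (k ∸ ∣ A ∣) !))
  first-hit F uniq k B ∣B∣≡k = begin
    k !
      ≡⟨ hit-strictly-below F uniq k B ∣B∣≡k ⟩
    a + r
      ≡⟨ cong (_+ r) (*-identityˡ a) ⟨
    1 * a + r
      ≡⟨ cong (λ c → c * a + r) (⟦¬⟧+⟦⟧ (B ∈? F)) ⟨
    (⟦ ¬? (B ∈? F) ⟧ + ⟦ B ∈? F ⟧) * a + r
      ≡⟨ regroup ⟦ ¬? (B ∈? F) ⟧ ⟦ B ∈? F ⟧ a r ⟩
    ⟦ ¬? (B ∈? F) ⟧ * a + (⟦ B ∈? F ⟧ * a + r)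
      ≡⟨ cong (⟦ ¬? (B ∈? F) ⟧ * a +_) (first-hit-sum F uniq k B ∣B∣≡k) ⟨
    ⟦ ¬? (B ∈? F) ⟧ * a + (∑[ A ← F ] ⟦ A ⊆? B ⟧ * (avoiders F A * (k ∸ ∣ A ∣) !)) ∎
    where
    open ≡-Reasoning
    a = avoiding F k B
    r = ∑[ A ← F ] avoiders F A * ((∑[ p ← coatoms B ] ⟦ A ⊆? p ⟧) * (pred k ∸ ∣ A ∣) !)

    regroup : ∀ s t c r → (s + t) * c + r ≡ s * c + (t * c + r)
    regroup = solve-∀

  -- The same sorting, with membership of `B` itself ignored. Every chain passes through one of the
  -- `k` coatoms of `B`, where `first-hit` applies; exchanging the sums then gathers, for each `A`,
  -- the coatoms that contain it.
  hit-strictly-below : (F : Family n) → Unique F → ∀ k (B : Subset n) → ∣ B ∣ ≡ k →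
    k ! ≡ avoiding F k B +
      (∑[ A ← F ] avoiders F A * ((∑[ p ← coatoms B ] ⟦ A ⊆? p ⟧) * (pred k ∸ ∣ A ∣) !))
  hit-strictly-below F uniq zero B ∣B∣≡0 with coatoms B in eq
  -- The empty set has no coatoms, so only the trivial chain is counted.
  ... | []    = cong suc (sym (∑-zero F λ {A} _ → *-zeroʳ (avoiders F A)))
  ... | _ ∷ _ = contradiction (trans (sym (cong length eq)) (trans (length-coatoms B) ∣B∣≡0)) λ ()
  hit-strictly-below F uniq (suc k) B ∣B∣≡1+k = begin
    suc k * k !
      ≡⟨ cong (_* k !) (trans (length-coatoms B) ∣B∣≡1+k) ⟨
    length (coatoms B) * k !
      ≡⟨ ∑-const (coatoms B) (k !) ⟨
    ∑[ p ← coatoms B ] k !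
      ≡⟨ ∑-cong (coatoms B) (λ {p} p∈ → first-hit F uniq k p (suc-injective (trans (∣coatom∣ {p = B} p∈) ∣B∣≡1+k))) ⟩
    ∑[ p ← coatoms B ] (⟦ ¬? (p ∈? F) ⟧ * avoiding F k p + (∑[ A ← F ] ⟦ A ⊆? p ⟧ * w A))
      ≡⟨ ∑-distrib-+ (coatoms B) (λ p → ⟦ ¬? (p ∈? F) ⟧ * avoiding F k p) (λ p → ∑[ A ← F ] ⟦ A ⊆? p ⟧ * w A) ⟩
    avoiding F (suc k) B + (∑[ p ← coatoms B ] ∑[ A ← F ] ⟦ A ⊆? p ⟧ * w A)
      ≡⟨ cong (avoiding F (suc k) B +_) (∑-swap (coatoms B) F (λ p A → ⟦ A ⊆? p ⟧ * w A)) ⟩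
    avoiding F (suc k) B + (∑[ A ← F ] ∑[ p ← coatoms B ] ⟦ A ⊆? p ⟧ * w A)
      ≡⟨ cong (avoiding F (suc k) B +_) (∑-cong F λ {A} _ → pull A) ⟩
    avoiding F (suc k) B + (∑[ A ← F ] avoiders F A * ((∑[ p ← coatoms B ] ⟦ A ⊆? p ⟧) * (k ∸ ∣ A ∣) !)) ∎
    where
    open ≡-Reasoning
    w : Subset _ → ℕ
    w A = avoiders F A * (k ∸ ∣ A ∣) !

    exchange : ∀ s c r → s * (c * r) ≡ c * (s * r)
    exchange = solve-∀

    pull : ∀ A → ∑[ p ← coatoms B ] ⟦ A ⊆? p ⟧ * w A ≡
                 avoiders F A * ((∑[ p ← coatoms B ] ⟦ A ⊆? p ⟧) * (k ∸ ∣ A ∣) !)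
    pull A = trans (sym (*-distribʳ-∑ (w A) (coatoms B) (λ p → ⟦ A ⊆? p ⟧)))
                   (exchange (∑[ p ← coatoms B ] ⟦ A ⊆? p ⟧) (avoiders F A) ((k ∸ ∣ A ∣) !))

-- For a duplicate-free `F`, the number of maximal chains from the empty set to `B` that meet `F`,
-- possibly only at `B`.
first-hits : Family n → Subset n → ℕ
first-hits F B = ∑[ A ← F ] ⟦ A ⊆? B ⟧ * (avoiders F A * (∣ B ∣ ∸ ∣ A ∣) !)

first-hits≤! : (F : Family n) → Unique F → ∀ B → first-hits F B ≤ ∣ B ∣ !
first-hits≤! F uniq B =
  ≤-trans (m≤n+m (first-hits F B) (⟦ ¬? (B ∈? F) ⟧ * avoiders F B))
          (≤-reflexive (sym (first-hit F uniq ∣ B ∣ B refl)))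

-- A chain that ends in a member of `F` meets `F`, so no chain is lost.
first-hits≡! : (F : Family n) → Unique F → ∀ {B} → B ∈ F → first-hits F B ≡ ∣ B ∣ !
first-hits≡! F uniq {B} B∈F =
  sym (trans (first-hit F uniq ∣ B ∣ B refl)
             (cong (λ c → c * avoiders F B + first-hits F B) (⟦⟧-false (λ B∉F → B∉F B∈F) (¬? (B ∈? F)))))

-- Chains hitting a family for the last time

coavoiders : Family n → Subset n → ℕ
coavoiders F C = avoiders (map ∁ F) (∁ C)

-- For a duplicate-free `F`, the number of maximal chains from `B` to the full set that meet `F`,
-- sorted by highest member `C`; `coavoiders F C` counts the continuations from `C` with no member
-- of `F` strictly above it.
last-hits : Family n → Subset n → ℕ
last-hits F B = ∑[ C ← F ] ⟦ B ⊆? C ⟧ * (coavoiders F C * (∣ C ∣ ∸ ∣ B ∣) !)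

∁-injective : {p q : Subset n} → ∁ p ≡ ∁ q → p ≡ q
∁-injective {p = p} {q} eq =
  ⊆-antisym (∁p⊆∁q⇒p⊇q (⊆-reflexive (sym eq))) (∁p⊆∁q⇒p⊇q (⊆-reflexive eq))

∣∁∣∸∣∁∣ : (p q : Subset n) → ∣ ∁ p ∣ ∸ ∣ ∁ q ∣ ≡ ∣ q ∣ ∸ ∣ p ∣
∣∁∣∸∣∁∣ {n = n} p q = begin
  ∣ ∁ p ∣ ∸ ∣ ∁ q ∣              ≡⟨ cong₂ _∸_ (∣∁p∣≡n∸∣p∣ p) (∣∁p∣≡n∸∣p∣ q) ⟩
  n ∸ ∣ p ∣ ∸ (n ∸ ∣ q ∣)        ≡⟨ ∸-+-assoc n ∣ p ∣ (n ∸ ∣ q ∣) ⟩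
  n ∸ (∣ p ∣ + (n ∸ ∣ q ∣))      ≡⟨ cong (n ∸_) (+-comm ∣ p ∣ (n ∸ ∣ q ∣)) ⟩
  n ∸ (n ∸ ∣ q ∣ + ∣ p ∣)        ≡⟨ ∸-+-assoc n (n ∸ ∣ q ∣) ∣ p ∣ ⟨
  n ∸ (n ∸ ∣ q ∣) ∸ ∣ p ∣        ≡⟨ cong (_∸ ∣ p ∣) (m∸[m∸n]≡n (∣p∣≤n q)) ⟩
  ∣ q ∣ ∸ ∣ p ∣                  ∎
  where open ≡-Reasoning

-- Complementation reverses inclusion and preserves differences of size, so it turns highest members
-- into lowest ones.
last-hits≡first-hits-∁ : (F : Family n) (B : Subset n) → last-hits F B ≡ first-hits (map ∁ F) (∁ B)
last-hits≡first-hits-∁ F B = sym (trans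
  (∑-map ∁ F (λ A → ⟦ A ⊆? ∁ B ⟧ * (avoiders (map ∁ F) A * (∣ ∁ B ∣ ∸ ∣ A ∣) !)))
  (∑-cong F λ {C} _ → cong₂ (λ i m → i * (coavoiders F C * m !))
    (⟦⟧-cong ∁p⊆∁q⇒p⊇q p⊆q⇒∁p⊇∁q (∁ C ⊆? ∁ B) (B ⊆? C))
    (∣∁∣∸∣∁∣ B C)))

last-hits≤! : (F : Family n) → Unique F → ∀ B → last-hits F B ≤ (n ∸ ∣ B ∣) !
last-hits≤! F uniq B = subst₂ _≤_ (sym (last-hits≡first-hits-∁ F B)) (cong _! (∣∁p∣≡n∸∣p∣ B))
  (first-hits≤! (map ∁ F) (Unique.map⁺ ∁-injective uniq) (∁ B))

last-hits≡! : (F : Family n) → Unique F → ∀ {B} → B ∈ F → last-hits F B ≡ (n ∸ ∣ B ∣) !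
last-hits≡! F uniq {B} B∈F = trans (last-hits≡first-hits-∁ F B)
  (trans (first-hits≡! (map ∁ F) (Unique.map⁺ ∁-injective uniq) (∈-map⁺ ∁ B∈F))
         (cong _! (∣∁p∣≡n∸∣p∣ B)))

-- Double counting of maximal chains by their lowest and highest members

through : Family n → Subset n → Subset n → ℕ
through F A C = ∑[ B ← F ] ⟦ A ⊆? B ⟧ * ⟦ B ⊆? C ⟧ * ((∣ B ∣ ∸ ∣ A ∣) ! * (∣ C ∣ ∸ ∣ B ∣) !)

-- The left side counts pairs of a maximal chain and a member `B` of `F` on it. Once the lowest
-- member `A` and the highest member `C` are fixed, the parts of the chain below `A` and above `C`
-- vary independently of the part between, where `through F A C` counts the pairs. By `bound` this
-- is at most `K` per chain of the interval, hence `K` per chain in total.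
LYM-by-intervals : (F : Family n) → Unique F → (K : ℕ) →
  (∀ {A C} → A ∈ F → C ∈ F → A ⊆ C → through F A C ≤ K * (∣ C ∣ ∸ ∣ A ∣) !) →
  ∑[ B ← F ] ∣ B ∣ ! * (n ∸ ∣ B ∣) ! ≤ K * n !
LYM-by-intervals {n = n} F uniq K bound = begin
  ∑[ B ← F ] ∣ B ∣ ! * (n ∸ ∣ B ∣) !
    -- As `B` belongs to `F`, every chain through it has a lowest member at or below `B` and a
    -- highest one at or above `B`.
    ≡⟨ ∑-cong F (λ B∈F → cong₂ _*_ (first-hits≡! F uniq B∈F) (last-hits≡! F uniq B∈F)) ⟨
  ∑[ B ← F ] first-hits F B * last-hits F B
    ≡⟨ ∑-cong F (λ {B} _ → expand B) ⟩
  ∑[ B ← F ] ∑[ C ← F ] ∑[ A ← F ] a A * c C * t A B C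
    ≡⟨ ∑-swap F F (λ B C → ∑[ A ← F ] a A * c C * t A B C) ⟩
  ∑[ C ← F ] ∑[ B ← F ] ∑[ A ← F ] a A * c C * t A B C
    ≡⟨ ∑-cong F (λ {C} _ → ∑-swap F F (λ B A → a A * c C * t A B C)) ⟩
  ∑[ C ← F ] ∑[ A ← F ] ∑[ B ← F ] a A * c C * t A B C
    ≡⟨ ∑-cong F (λ {C} _ → ∑-cong F (λ {A} _ → *-distribˡ-∑ (a A * c C) F (λ B → t A B C))) ⟨
  ∑[ C ← F ] ∑[ A ← F ] a A * c C * through F A C
    ≤⟨ ∑-mono F (λ {C} C∈F → ∑-mono F (λ {A} A∈F → *-monoʳ-≤ (a A * c C) (interval A∈F C∈F))) ⟩
  ∑[ C ← F ] ∑[ A ← F ] a A * c C * (⟦ A ⊆? C ⟧ * (K * (∣ C ∣ ∸ ∣ A ∣) !))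
    ≡⟨ ∑-cong F (λ {C} _ → collect C) ⟩
  ∑[ C ← F ] K * c C * first-hits F C
    -- Summing over `A` gave the chains from the empty set to `C` that meet `F`, at most all of
    -- them.
    ≤⟨ ∑-mono F (λ {C} _ → *-monoʳ-≤ (K * c C) (first-hits≤! F uniq C)) ⟩
  ∑[ C ← F ] K * c C * ∣ C ∣ !
    -- Read as chains starting at `⊥`, the terms form `last-hits F ⊥`: the chains of the whole
    -- lattice sorted by highest member.
    ≡⟨ ∑-cong F (λ {C} _ → from-⊥ C) ⟩
  ∑[ C ← F ] K * (⟦ ⊥ ⊆? C ⟧ * (c C * (∣ C ∣ ∸ ∣ ⊥ {n} ∣) !))
    ≡⟨ *-distribˡ-∑ K F (λ C → ⟦ ⊥ ⊆? C ⟧ * (c C * (∣ C ∣ ∸ ∣ ⊥ {n} ∣) !)) ⟨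
  K * last-hits F ⊥
    ≤⟨ *-monoʳ-≤ K (last-hits≤! F uniq ⊥) ⟩
  K * (n ∸ ∣ ⊥ {n} ∣) !
    ≡⟨ cong (λ m → K * (n ∸ m) !) (∣⊥∣≡0 n) ⟩
  K * n ! ∎
  where
  open ≤-Reasoning
  a = avoiders F
  c = coavoiders F

  t : Subset n → Subset n → Subset n → ℕ
  t A B C = ⟦ A ⊆? B ⟧ * ⟦ B ⊆? C ⟧ * ((∣ B ∣ ∸ ∣ A ∣) ! * (∣ C ∣ ∸ ∣ B ∣) !)

  rearrange : ∀ i x p j y q → i * (x * p) * (j * (y * q)) ≡ x * y * (i * j * (p * q))
  rearrange = solve-∀

  expand : ∀ B → first-hits F B * last-hits F B ≡ ∑[ C ← F ] ∑[ A ← F ] a A * c C * t A B C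
  expand B = trans (*-distribˡ-∑ (first-hits F B) F _) (∑-cong F λ {C} _ →
    trans (*-distribʳ-∑ _ F (λ A → ⟦ A ⊆? B ⟧ * (a A * (∣ B ∣ ∸ ∣ A ∣) !))) (∑-cong F λ {A} _ →
      rearrange ⟦ A ⊆? B ⟧ (a A) ((∣ B ∣ ∸ ∣ A ∣) !) ⟦ B ⊆? C ⟧ (c C) ((∣ C ∣ ∸ ∣ B ∣) !)))

  interval : ∀ {A C} → A ∈ F → C ∈ F → through F A C ≤ ⟦ A ⊆? C ⟧ * (K * (∣ C ∣ ∸ ∣ A ∣) !)
  interval {A} {C} A∈F C∈F with A ⊆? C
  ... | yes A⊆C = ≤-trans (bound A∈F C∈F A⊆C) (≤-reflexive (sym (*-identityˡ _)))
  ... | no  A⊈C = ≤-reflexive (∑-zero F λ {B} _ → vanish (A ⊆? B) (B ⊆? C))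
    where
    vanish : ∀ {B m} (d : Dec (A ⊆ B)) (e : Dec (B ⊆ C)) → ⟦ d ⟧ * ⟦ e ⟧ * m ≡ 0
    vanish (no _)    e         = refl
    vanish (yes _)   (no _)    = refl
    vanish (yes A⊆B) (yes B⊆C) = ⊥-elim (A⊈C (⊆-trans A⊆B B⊆C))

  collect : ∀ C → ∑[ A ← F ] a A * c C * (⟦ A ⊆? C ⟧ * (K * (∣ C ∣ ∸ ∣ A ∣) !)) ≡ K * c C * first-hits F C
  collect C = sym (trans (*-distribˡ-∑ (K * c C) F _)
    (∑-cong F λ {A} _ → reorder K (c C) ⟦ A ⊆? C ⟧ (a A) ((∣ C ∣ ∸ ∣ A ∣) !)))
    where
    reorder : ∀ k y i x p → k * y * (i * (x * p)) ≡ x * y * (i * (k * p))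
    reorder = solve-∀

  from-⊥ : ∀ C → K * c C * ∣ C ∣ ! ≡ K * (⟦ ⊥ ⊆? C ⟧ * (c C * (∣ C ∣ ∸ ∣ ⊥ {n} ∣) !))
  from-⊥ C rewrite ∣⊥∣≡0 n | ⟦⟧-true {P = ⊥ ⊆ C} ⊥⊆ (⊥ ⊆? C) = reorder K (c C) (∣ C ∣ !)
    where
    reorder : ∀ k y m → k * y * m ≡ k * (1 * (y * m))
    reorder = solve-∀

-- Levels of an interval

-- Raising `x` by one multiplies the left side by `a + x + 1` and the right side by the larger
-- `a + x + y + 1`. Hence a product of two factorials with fixed sum of arguments grows as the
-- arguments move apart.
!-log-convex : ∀ a x y → (a + x) ! * (a + y) ! ≤ a ! * (a + x + y) !
!-log-convex a zero y rewrite +-identityʳ a = ≤-refl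
!-log-convex a (suc x) y rewrite +-suc a x = begin
  suc (a + x) * (a + x) ! * (a + y) !      ≡⟨ *-assoc (suc (a + x)) ((a + x) !) ((a + y) !) ⟩
  suc (a + x) * ((a + x) ! * (a + y) !)    ≤⟨ *-mono-≤ (s≤s (m≤m+n (a + x) y)) (!-log-convex a x y) ⟩
  suc (a + x + y) * (a ! * (a + x + y) !)  ≡⟨ exchange (suc (a + x + y)) (a !) ((a + x + y) !) ⟩
  a ! * (suc (a + x + y) * (a + x + y) !)  ∎
  where
  open ≤-Reasoning
  exchange : ∀ p q r → p * (q * r) ≡ q * (p * r)
  exchange = solve-∀

∑-by-level : (κ : X → ℕ) (m : ℕ) (f : ℕ → ℕ) (xs : List X) → (∀ {x} → x ∈ xs → κ x < m) →
             ∑[ x ← xs ] f (κ x) ≡ ∑[ j ← upTo m ] length (filter (λ x → j ≟ κ x) xs) * f j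
∑-by-level κ m f xs κ< = begin
  ∑[ x ← xs ] f (κ x)
    -- Each value is spread over all levels, of which only `κ x` contributes.
    ≡⟨ ∑-cong xs (λ {x} x∈ → trans (∑-select _≟_ f (Unique.upTo⁺ m) (yes (∈-upTo⁺ (κ< x∈)))) (*-identityˡ (f (κ x)))) ⟨
  ∑[ x ← xs ] ∑[ j ← upTo m ] ⟦ j ≟ κ x ⟧ * f j
    ≡⟨ ∑-swap xs (upTo m) (λ x j → ⟦ j ≟ κ x ⟧ * f j) ⟩
  ∑[ j ← upTo m ] ∑[ x ← xs ] ⟦ j ≟ κ x ⟧ * f j
    ≡⟨ ∑-cong (upTo m) (λ {j} _ → trans (sym (∑-filter (λ x → j ≟ κ x) xs (λ _ → f j)))
                                         (∑-const (filter (λ x → j ≟ κ x) xs) (f j))) ⟩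
  ∑[ j ← upTo m ] length (filter (λ x → j ≟ κ x) xs) * f j ∎
  where
  open ≡-Reasoning

∑-upTo-last : (m : ℕ) (f : ℕ → ℕ) → ∑ (upTo (suc m)) f ≡ ∑ (upTo m) f + f m
∑-upTo-last m f = begin
  ∑ (upTo (suc m)) f        ≡⟨ cong (λ l → ∑ l f) (upTo-∷ʳ m) ⟨
  ∑ (upTo m ++ m ∷ []) f    ≡⟨ ∑-++ (upTo m) (m ∷ []) f ⟩
  ∑ (upTo m) f + (f m + 0)  ≡⟨ cong (∑ (upTo m) f +_) (+-identityʳ (f m)) ⟩
  ∑ (upTo m) f + f m        ∎
  where open ≡-Reasoning

-- `N j` stands for the number of members of rank `j` in an interval of rank `d`, each on
-- `j ! * (d ∸ j) !` of its chains. The ends give at most `2 * d !`. For `d` at least 4, levels 1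
-- and `d ∸ 1` give at most `3 * (d ∸ 1) !` each, and the `d ∸ 3` levels between them at most
-- `6 * (d ∸ 2) !` each.
levels-bound : ∀ d (N : ℕ → ℕ) → N 0 ≤ 1 → N d ≤ 1 → (∀ j → 0 < j → j < d → N j ≤ 3) →
               ∑[ j ← upTo (suc d) ] N j * (j ! * (d ∸ j) !) ≤ 4 * d !
levels-bound 0 N N₀ N₀′ N≤3 = ≤-trans (+-mono-≤ (*-monoˡ-≤ 1 N₀) z≤n) (m≤m+n 1 3)
levels-bound 1 N N₀ N₁ N≤3 =
  ≤-trans (+-mono-≤ (*-monoˡ-≤ 1 N₀) (+-mono-≤ (*-monoˡ-≤ 1 N₁) z≤n)) (m≤m+n 2 2)
levels-bound 2 N N₀ N₂ N≤3 =
  ≤-trans (+-mono-≤ (*-monoˡ-≤ 2 N₀) (+-mono-≤ (*-monoˡ-≤ 1 (N≤3 1 ≤-refl ≤-refl)) (+-mono-≤ (*-monoˡ-≤ 2 N₂) z≤n)))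
          (m≤m+n 7 1)
levels-bound 3 N N₀ N₃ N≤3 =
  +-mono-≤ (*-monoˡ-≤ 6 N₀) (+-mono-≤ (*-monoˡ-≤ 2 (N≤3 1 ≤-refl (m≤m+n 2 1)))
    (+-mono-≤ (*-monoˡ-≤ 2 (N≤3 2 (m≤m+n 1 1) ≤-refl)) (+-mono-≤ (*-monoˡ-≤ 6 N₃) z≤n)))
levels-bound d@(suc (suc (suc (suc e)))) N N₀ Nₜ N≤3 = begin
  ∑ (upTo (5 + e)) φ
    ≡⟨ ∑-upTo-last (4 + e) φ ⟩
  ∑ (upTo (4 + e)) φ + φ d
    -- Levels `d` and `d ∸ 1` are peeled off the end; levels 0 and 1 split off by computation,
    -- leaving 2 to `d ∸ 2` as `inner`.
    ≡⟨ cong (_+ φ d) (∑-upTo-last (3 + e) φ) ⟩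
  φ 0 + (φ 1 + ∑ inner φ) + φ (3 + e) + φ d
    ≤⟨ +-mono-≤ (+-mono-≤ (+-mono-≤ φ₀ (+-mono-≤ φ₁ φ-inner)) φ₃₊ₑ) φ-top ⟩
  1 * (1 * d !) + (3 * (1 * (3 + e) !) + (1 + e) * (3 * (2 * q))) + 3 * ((3 + e) ! * 1) + 1 * (d ! * 1)
    -- The added term is the exact slack, `2 * (d ∸ 3) * (d ∸ 4) * (d ∸ 2) !`; it is 0 at `d = 4`.
    ≤⟨ m≤m+n _ ((2 * e * e + 2 * e) * q) ⟩
  1 * (1 * d !) + (3 * (1 * (3 + e) !) + (1 + e) * (3 * (2 * q))) + 3 * ((3 + e) ! * 1) + 1 * (d ! * 1)
    + (2 * e * e + 2 * e) * q
    ≡⟨ arithmetic e q ⟩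
  4 * d ! ∎
  where
  open ≤-Reasoning
  φ : ℕ → ℕ
  φ j = N j * (j ! * (d ∸ j) !)

  q = (2 + e) !
  inner = applyUpTo (2 +_) (1 + e)

  arithmetic : ∀ e q →
    1 * (1 * ((4 + e) * ((3 + e) * q))) + (3 * (1 * ((3 + e) * q)) + (1 + e) * (3 * (2 * q))) + 3 * ((3 + e) * q * 1)
      + 1 * ((4 + e) * ((3 + e) * q) * 1) + (2 * e * e + 2 * e) * q
    ≡ 4 * ((4 + e) * ((3 + e) * q))
  arithmetic = solve-∀

  φ₀ : φ 0 ≤ 1 * (1 * d !)
  φ₀ = *-monoˡ-≤ (1 * d !) N₀

  φ₁ : φ 1 ≤ 3 * (1 * (3 + e) !)
  φ₁ = *-monoˡ-≤ (1 * (3 + e) !) (N≤3 1 ≤-refl (s≤s (s≤s z≤n)))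

  φ₃₊ₑ : φ (3 + e) ≤ 3 * ((3 + e) ! * 1)
  φ₃₊ₑ = *-mono-≤ (N≤3 (3 + e) (s≤s z≤n) ≤-refl)
                  (*-monoʳ-≤ ((3 + e) !) (≤-reflexive (cong _! (m+n∸n≡m 1 (3 + e)))))

  φ-top : φ d ≤ 1 * (d ! * 1)
  φ-top = *-mono-≤ Nₜ (*-monoʳ-≤ (d !) (≤-reflexive (cong _! (n∸n≡0 d))))

  φ-inner : ∑ inner φ ≤ (1 + e) * (3 * (2 * q))
  φ-inner = begin
    ∑ inner φ                       ≤⟨ ∑-mono inner (λ j∈ → term (∈-applyUpTo⁻ (2 +_) j∈)) ⟩
    ∑[ j ← inner ] 3 * (2 * q)      ≡⟨ ∑-const inner (3 * (2 * q)) ⟩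
    length inner * (3 * (2 * q))    ≡⟨ cong (_* (3 * (2 * q))) (length-applyUpTo (2 +_) (1 + e)) ⟩
    (1 + e) * (3 * (2 * q))         ∎
    where
    term : ∀ {j} → ∃ (λ i → i < 1 + e × j ≡ 2 + i) → φ j ≤ 3 * (2 * q)
    -- Both `j` and `d ∸ j` are at least 2, so log-convexity at `a = 2` pushes the product out to
    -- `2 ! * (d ∸ 2) !`.
    term (i , s≤s i≤e , refl) = *-mono-≤ (N≤3 (2 + i) (s≤s z≤n) (s≤s (s≤s (s≤s (m≤n⇒m≤1+n i≤e))))) (begin
      (2 + i) ! * (2 + e ∸ i) !    ≡⟨ cong (λ k → (2 + i) ! * k !) (+-∸-assoc 2 i≤e) ⟩
      (2 + i) ! * (2 + (e ∸ i)) !  ≤⟨ !-log-convex 2 i (e ∸ i) ⟩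
      2 * (2 + i + (e ∸ i)) !      ≡⟨ cong (λ k → 2 * (2 + k) !) (m+[n∸m]≡n i≤e) ⟩
      2 * q                        ∎)

length≤3 : Unique xs →
  (∀ {a b c d} → a ∈ xs → b ∈ xs → c ∈ xs → d ∈ xs →
     ¬ (¬ a ≡ b × ¬ a ≡ c × ¬ a ≡ d × ¬ b ≡ c × ¬ b ≡ d × ¬ c ≡ d)) →
  length xs ≤ 3
length≤3 {xs = []}             uniq none = z≤n
length≤3 {xs = _ ∷ []}         uniq none = s≤s z≤n
length≤3 {xs = _ ∷ _ ∷ []}     uniq none = s≤s (s≤s z≤n)
length≤3 {xs = _ ∷ _ ∷ _ ∷ []} uniq none = s≤s (s≤s (s≤s z≤n))
length≤3 {xs = _ ∷ _ ∷ _ ∷ _ ∷ _}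
  ((a≢b ∷ a≢c ∷ a≢d ∷ _) ∷ (b≢c ∷ b≢d ∷ _) ∷ (c≢d ∷ _) ∷ _) none =
  ⊥-elim (none (here refl) (there (here refl)) (there (there (here refl))) (there (there (there (here refl))))
               (a≢b , a≢c , a≢d , b≢c , b≢d , c≢d))

⟦×-dec⟧ : (p? : Dec P) (q? : Dec Q) → ⟦ p? ×-dec q? ⟧ ≡ ⟦ p? ⟧ * ⟦ q? ⟧
⟦×-dec⟧ (yes _) (yes _) = refl
⟦×-dec⟧ (yes _) (no  _) = refl
⟦×-dec⟧ (no  _) q?      = refl

-- Members of `F` in the interval are grouped by rank over `A`. Nested sets of equal size coincide,
-- so ranks 0 and `d` hold only `A` and `C`; four members of one rank strictly between would
-- complete a configuration.
through≤4! : (F : Family n) → Unique F → ¬ Config F → ∀ {A C} → A ∈ F → C ∈ F → A ⊆ C →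
             through F A C ≤ 4 * (∣ C ∣ ∸ ∣ A ∣) !
through≤4! {n} F uniq ¬config {A} {C} A∈F C∈F A⊆C = begin
  through F A C
    ≡⟨ ∑-cong F (λ {B} _ → cong (_* ((∣ B ∣ ∸ ∣ A ∣) ! * (∣ C ∣ ∸ ∣ B ∣) !)) (⟦×-dec⟧ (A ⊆? B) (B ⊆? C))) ⟨
  ∑[ B ← F ] ⟦ between? B ⟧ * ((∣ B ∣ ∸ ∣ A ∣) ! * (∣ C ∣ ∸ ∣ B ∣) !)
    ≡⟨ ∑-filter between? F (λ B → (∣ B ∣ ∸ ∣ A ∣) ! * (∣ C ∣ ∸ ∣ B ∣) !) ⟨
  ∑[ B ← I ] (∣ B ∣ ∸ ∣ A ∣) ! * (∣ C ∣ ∸ ∣ B ∣) !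
    ≡⟨ ∑-cong I (λ {B} B∈I → cong (λ k → (κ B) ! * k !) (corank B∈I)) ⟨
  ∑[ B ← I ] (κ B) ! * (d ∸ κ B) !
    ≡⟨ ∑-by-level κ (suc d) (λ j → j ! * (d ∸ j) !) I (λ B∈I → s≤s (rank≤d B∈I)) ⟩
  ∑[ j ← upTo (suc d) ] length (level j) * (j ! * (d ∸ j) !)
    ≤⟨ levels-bound d (λ j → length (level j)) bottom top inner ⟩
  4 * d ! ∎
  where
  open ≤-Reasoning
  d = ∣ C ∣ ∸ ∣ A ∣

  κ : Subset n → ℕ
  κ B = ∣ B ∣ ∸ ∣ A ∣

  between? : Decidable (λ B → A ⊆ B × B ⊆ C)
  between? B = (A ⊆? B) ×-dec (B ⊆? C)

  I : Family n
  I = filter between? F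

  level : ℕ → Family n
  level j = filter (λ B → j ≟ κ B) I

  level-unique : ∀ j → Unique (level j)
  level-unique j = Unique.filter⁺ (λ B → j ≟ κ B) (Unique.filter⁺ between? uniq)

  ∈I : ∀ {B} → B ∈ I → B ∈ F × A ⊆ B × B ⊆ C
  ∈I = ∈-filter⁻ between? {xs = F}

  ∈level : ∀ {j B} → B ∈ level j → B ∈ I × j ≡ κ B
  ∈level {j} = ∈-filter⁻ (λ B → j ≟ κ B) {xs = I}

  ∣A∣≤ : ∀ {B} → B ∈ I → ∣ A ∣ ≤ ∣ B ∣
  ∣A∣≤ B∈I = p⊆q⇒∣p∣≤∣q∣ (proj₁ (proj₂ (∈I B∈I)))

  rank≤d : ∀ {B} → B ∈ I → κ B ≤ d
  rank≤d B∈I = ∸-monoˡ-≤ ∣ A ∣ (p⊆q⇒∣p∣≤∣q∣ (proj₂ (proj₂ (∈I B∈I))))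

  corank : ∀ {B} → B ∈ I → d ∸ κ B ≡ ∣ C ∣ ∸ ∣ B ∣
  corank {B} B∈I = trans (∸-+-assoc ∣ C ∣ ∣ A ∣ (κ B)) (cong (∣ C ∣ ∸_) (m+[n∸m]≡n (∣A∣≤ B∈I)))

  bottom : length (level 0) ≤ 1
  bottom = length-⊆ {ys = A ∷ []} (level-unique 0) λ {B} B∈ →
    let B∈I , 0≡κ = ∈level B∈
    in  here (sym (⊆∧∣∣≡⇒≡ (proj₁ (proj₂ (∈I B∈I))) (≤-antisym (∣A∣≤ B∈I) (m∸n≡0⇒m≤n (sym 0≡κ)))))

  top : length (level d) ≤ 1
  top = length-⊆ {ys = C ∷ []} (level-unique d) λ {B} B∈ →
    let B∈I , d≡κ = ∈level B∈
    in  here (⊆∧∣∣≡⇒≡ (proj₂ (proj₂ (∈I B∈I))) (∸-cancelʳ-≡ (∣A∣≤ B∈I) (p⊆q⇒∣p∣≤∣q∣ A⊆C) (sym d≡κ)))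

  inner : ∀ j → 0 < j → j < d → length (level j) ≤ 3
  inner j 0<j j<d = length≤3 (level-unique j) λ B₁∈ B₂∈ B₃∈ B₄∈ distinct →
    ¬config (A , _ , _ , _ , _ , C
      , (A∈F , ∈F B₁∈ , ∈F B₂∈ , ∈F B₃∈ , ∈F B₄∈ , C∈F)
      , (A⊂ B₁∈ , A⊂ B₂∈ , A⊂ B₃∈ , A⊂ B₄∈)
      , (⊂C B₁∈ , ⊂C B₂∈ , ⊂C B₃∈ , ⊂C B₄∈)
      , (same-size B₁∈ B₂∈ , same-size B₁∈ B₃∈ , same-size B₁∈ B₄∈)
      , distinct)
    where
    ∈F : ∀ {B} → B ∈ level j → B ∈ F
    ∈F B∈ = proj₁ (∈I (proj₁ (∈level B∈)))

    A⊂ : ∀ {B} → B ∈ level j → A ⊂ B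
    A⊂ {B} B∈ with ∈level B∈
    ... | B∈I , refl = ⊆∧∣∣<⇒⊂ (proj₁ (proj₂ (∈I B∈I))) (m∸n≢0⇒n<m (>⇒≢ 0<j))

    ⊂C : ∀ {B} → B ∈ level j → B ⊂ C
    ⊂C {B} B∈ with ∈level B∈
    ... | B∈I , refl = ⊆∧∣∣<⇒⊂ (proj₂ (proj₂ (∈I B∈I)))
      (≰⇒> λ ∣C∣≤∣B∣ → <⇒≱ j<d (∸-monoˡ-≤ ∣ A ∣ ∣C∣≤∣B∣))

    same-size : ∀ {B B′} → B ∈ level j → B′ ∈ level j → ∣ B ∣ ≡ ∣ B′ ∣
    same-size B∈ B′∈ with ∈level B∈ | ∈level B′∈
    ... | B∈I , j≡κ | B′∈I , j≡κ′ = ∸-cancelʳ-≡ (∣A∣≤ B∈I) (∣A∣≤ B′∈I) (trans (sym j≡κ) j≡κ′)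

-- Levels of the Boolean lattice

ofSize : ∀ n → ℕ → List (Subset n)
ofSize zero    zero    = [] ∷ []
ofSize zero    (suc k) = []
ofSize (suc n) zero    = map (outside ∷_) (ofSize n zero)
ofSize (suc n) (suc k) = map (inside ∷_) (ofSize n k) ++ map (outside ∷_) (ofSize n (suc k))

length-ofSize : ∀ n k → length (ofSize n k) ≡ n choose k
length-ofSize zero    zero    = refl
length-ofSize zero    (suc k) = refl
length-ofSize (suc n) zero    = trans (length-map (outside ∷_) (ofSize n zero)) (length-ofSize n zero)
length-ofSize (suc n) (suc k) = begin
  length (map (inside ∷_) (ofSize n k) ++ map (outside ∷_) (ofSize n (suc k)))
    ≡⟨ length-++ (map (inside ∷_) (ofSize n k)) ⟩
  length (map (inside ∷_) (ofSize n k)) + length (map (outside ∷_) (ofSize n (suc k)))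
    ≡⟨ cong₂ _+_ (length-map (inside ∷_) (ofSize n k)) (length-map (outside ∷_) (ofSize n (suc k))) ⟩
  length (ofSize n k) + length (ofSize n (suc k))
    ≡⟨ cong₂ _+_ (length-ofSize n k) (length-ofSize n (suc k)) ⟩
  n choose k + n choose (suc k)
    ≡⟨ nCk+nC[k+1]≡[n+1]C[k+1] n k ⟩
  suc n choose suc k ∎
  where open ≡-Reasoning

∈-ofSize⁺ : (p : Subset n) → p ∈ ofSize n ∣ p ∣
∈-ofSize⁺ []            = here refl
∈-ofSize⁺ (inside ∷ p)  = ∈-++⁺ˡ (∈-map⁺ (inside ∷_) (∈-ofSize⁺ p))
-- `ofSize (suc n)` reduces only once its second argument is split.
∈-ofSize⁺ {suc n} (outside ∷ p) with ∣ p ∣ | ∈-ofSize⁺ p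
... | zero  | p∈ = ∈-map⁺ (outside ∷_) p∈
... | suc k | p∈ = ∈-++⁺ʳ (map (inside ∷_) (ofSize n k)) (∈-map⁺ (outside ∷_) p∈)

∈-ofSize⁻ : ∀ n k {p : Subset n} → p ∈ ofSize n k → ∣ p ∣ ≡ k
∈-ofSize⁻ zero    zero    (here refl) = refl
∈-ofSize⁻ (suc n) zero    p∈ with ∈-map⁻ (outside ∷_) p∈
... | _ , q∈ , refl = ∈-ofSize⁻ n zero q∈
∈-ofSize⁻ (suc n) (suc k) p∈ with ∈-++⁻ (map (inside ∷_) (ofSize n k)) p∈
... | inj₁ p∈ˡ with ∈-map⁻ (inside ∷_) p∈ˡ
...   | _ , q∈ , refl = cong suc (∈-ofSize⁻ n k q∈)
∈-ofSize⁻ (suc n) (suc k) p∈ | inj₂ p∈ʳ with ∈-map⁻ (outside ∷_) p∈ʳ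
...   | _ , q∈ , refl = ∈-ofSize⁻ n (suc k) q∈

ofSize-unique : ∀ n k → Unique (ofSize n k)
ofSize-unique zero    zero    = [] ∷ []
ofSize-unique zero    (suc k) = []
ofSize-unique (suc n) zero    = Unique.map⁺ ∷-injectiveʳ (ofSize-unique n zero)
ofSize-unique (suc n) (suc k) = Unique.++⁺
  (Unique.map⁺ ∷-injectiveʳ (ofSize-unique n k)) (Unique.map⁺ ∷-injectiveʳ (ofSize-unique n (suc k))) disjoint
  where
  disjoint : ∀ {p} → ¬ (p ∈ map (inside ∷_) (ofSize n k) × p ∈ map (outside ∷_) (ofSize n (suc k)))
  disjoint (p∈ , p∈′) with ∈-map⁻ (inside ∷_) p∈ | ∈-map⁻ (outside ∷_) p∈′
  ... | _ , _ , refl | _ , _ , ()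

-- Indexed by offsets from `lo`, as in `sumRange`, so that its length becomes a sum of that form.
sizeRange : ∀ n → ℕ → ℕ → Family n
sizeRange n lo m = concat (map (λ j → ofSize n (lo + j)) (upTo m))

∑-concat : (h : ℕ → List X) (js : List ℕ) (f : X → ℕ) →
           ∑ (concat (map h js)) f ≡ ∑[ j ← js ] ∑ (h j) f
∑-concat h []       f = refl
∑-concat h (j ∷ js) f =
  trans (∑-++ (h j) (concat (map h js)) f) (cong (∑ (h j) f +_) (∑-concat h js f))

length-sizeRange : ∀ n lo m → length (sizeRange n lo m) ≡ ∑[ j ← upTo m ] n choose (lo + j)
length-sizeRange n lo m = begin
  length (sizeRange n lo m)
    ≡⟨ ∑-one (sizeRange n lo m) ⟨
  ∑[ p ← sizeRange n lo m ] 1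
    ≡⟨ ∑-concat (λ j → ofSize n (lo + j)) (upTo m) (λ _ → 1) ⟩
  ∑[ j ← upTo m ] ∑[ p ← ofSize n (lo + j) ] 1
    ≡⟨ ∑-cong (upTo m) (λ {j} _ → trans (∑-one (ofSize n (lo + j))) (length-ofSize n (lo + j))) ⟩
  ∑[ j ← upTo m ] n choose (lo + j) ∎
  where open ≡-Reasoning

∈-sizeRange⁺ : ∀ n lo m {p : Subset n} → lo ≤ ∣ p ∣ → ∣ p ∣ < lo + m → p ∈ sizeRange n lo m
∈-sizeRange⁺ n lo m {p} lo≤ <lo+m = ∈-concat⁺′ {vs = ofSize n (lo + (∣ p ∣ ∸ lo))}
  (subst (λ k → p ∈ ofSize n k) (sym (m+[n∸m]≡n lo≤)) (∈-ofSize⁺ p))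
  (∈-map⁺ (λ j → ofSize n (lo + j)) (∈-upTo⁺ (+-cancelˡ-< lo _ _ (subst (_< lo + m) (sym (m+[n∸m]≡n lo≤)) <lo+m))))

∈-sizeRange⁻ : ∀ n lo m {p : Subset n} → p ∈ sizeRange n lo m → lo ≤ ∣ p ∣ × ∣ p ∣ < lo + m
∈-sizeRange⁻ n lo m p∈ with ∈-concat⁻′ (map (λ j → ofSize n (lo + j)) (upTo m)) p∈
... | _ , p∈ₗ , l∈ with ∈-map⁻ (λ j → ofSize n (lo + j)) l∈
...   | j , j∈ , refl rewrite ∈-ofSize⁻ n (lo + j) p∈ₗ = m≤m+n lo j , +-monoʳ-< lo (∈-upTo⁻ j∈)

sizeRange-unique : ∀ n lo m → Unique (sizeRange n lo m)
sizeRange-unique n lo m = Unique.concat⁺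
  (All.map⁺ (All.tabulate λ {j} _ → ofSize-unique n (lo + j)))
  (AllPairs.map⁺ (AllPairs.applyUpTo⁺₁ (λ j → j) m λ {i} {j} i<j _ (p∈ , p∈′) →
    <⇒≢ i<j (+-cancelˡ-≡ lo i j (trans (sym (∈-ofSize⁻ n (lo + i) p∈)) (∈-ofSize⁻ n (lo + j) p∈′)))))

-- From total weight to the size of a family

weight : ℕ → ℕ → ℕ
weight n k = k ! * (n ∸ k) !

-- `weight n k` is the number of maximal chains through a given set of size `k`, and each of the
-- `n !` chains has one set of that size.
nCk*weight : ∀ {n k} → k ≤ n → (n choose k) * weight n k ≡ n !
nCk*weight {n} {k} k≤n =
  trans (cong (_* weight n k) (nCk≡n!/k![n-k]! k≤n)) (m/n*n≡m (k![n∸k]!∣n! k≤n))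
  where instance _ = k !* (n ∸ k) !≢0

-- Every full level weighs `n !`. The hypothesis keeps all sizes at most `n`, since larger ones give
-- empty levels.
∑-weight-sizeRange : ∀ n lo m → lo + m ≤ suc n →
                     ∑[ p ← sizeRange n lo m ] weight n ∣ p ∣ ≡ m * n !
∑-weight-sizeRange n lo m lo+m≤1+n = begin
  ∑[ p ← sizeRange n lo m ] weight n ∣ p ∣
    ≡⟨ ∑-concat (λ j → ofSize n (lo + j)) (upTo m) (λ p → weight n ∣ p ∣) ⟩
  ∑[ j ← upTo m ] ∑[ p ← ofSize n (lo + j) ] weight n ∣ p ∣
    ≡⟨ ∑-cong (upTo m) (λ {j} j∈ → level j (≤-pred (≤-trans (+-monoʳ-< lo (∈-upTo⁻ j∈)) lo+m≤1+n))) ⟩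
  ∑[ j ← upTo m ] n !
    ≡⟨ ∑-const (upTo m) (n !) ⟩
  length (upTo m) * n !
    ≡⟨ cong (_* n !) (length-applyUpTo (λ j → j) m) ⟩
  m * n ! ∎
  where
  open ≡-Reasoning
  level : ∀ j → lo + j ≤ n → ∑[ p ← ofSize n (lo + j) ] weight n ∣ p ∣ ≡ n !
  level j lo+j≤n = begin
    ∑[ p ← ofSize n (lo + j) ] weight n ∣ p ∣
      ≡⟨ ∑-cong (ofSize n (lo + j)) (λ p∈ → cong (weight n) (∈-ofSize⁻ n (lo + j) p∈)) ⟩
    ∑[ p ← ofSize n (lo + j) ] weight n (lo + j)
      ≡⟨ ∑-const (ofSize n (lo + j)) (weight n (lo + j)) ⟩
    length (ofSize n (lo + j)) * weight n (lo + j)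
      ≡⟨ cong (_* weight n (lo + j)) (length-ofSize n (lo + j)) ⟩
    (n choose (lo + j)) * weight n (lo + j)
      ≡⟨ nCk*weight lo+j≤n ⟩
    n ! ∎

-- The hypotheses say that `a` is at least as far from the middle as `k`; log-convexity then applies
-- with shifts `k ∸ a` and `n ∸ k ∸ a`.
weight-antitone : ∀ {n a k} → a ≤ k → a ≤ n ∸ k → k ≤ n → weight n k ≤ weight n a
weight-antitone {n} {a} {k} a≤k a≤n∸k k≤n = begin
  k ! * (n ∸ k) !
    ≡⟨ cong₂ (λ i j → i ! * j !) (m+[n∸m]≡n a≤k) (m+[n∸m]≡n a≤n∸k) ⟨
  (a + (k ∸ a)) ! * (a + (n ∸ k ∸ a)) !
    ≤⟨ !-log-convex a (k ∸ a) (n ∸ k ∸ a) ⟩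
  a ! * (a + (k ∸ a) + (n ∸ k ∸ a)) !
    ≡⟨ cong (λ j → a ! * j !) complement ⟩
  a ! * (n ∸ a) ! ∎
  where
  open ≤-Reasoning
  complement : a + (k ∸ a) + (n ∸ k ∸ a) ≡ n ∸ a
  complement = begin-equality
    a + (k ∸ a) + (n ∸ k ∸ a)  ≡⟨ cong (_+ (n ∸ k ∸ a)) (m+[n∸m]≡n a≤k) ⟩
    k + (n ∸ k ∸ a)            ≡⟨ +-∸-assoc k a≤n∸k ⟨
    k + (n ∸ k) ∸ a            ≡⟨ cong (_∸ a) (m+[n∸m]≡n k≤n) ⟩
    n ∸ a                      ∎

weight-sym : ∀ {n k} → k ≤ n → weight n (n ∸ k) ≡ weight n k
weight-sym {n} {k} k≤n = trans (cong ((n ∸ k) ! *_) (cong _! (m∸[m∸n]≡n k≤n))) (*-comm ((n ∸ k) !) (k !))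

-- Sets outside the range weigh at least ℓ = weight n lo, those inside at most ℓ, so trading the former
-- for the latter at fixed total weight can only increase the size of the family.
LYM⇒length≤ : ∀ n lo m → m + (lo + lo) ≤ n → n ≤ lo + suc m + lo → (F : Family n) → Unique F →
              ∑[ B ← F ] weight n ∣ B ∣ ≤ suc m * n ! → length F ≤ length (sizeRange n lo (suc m))
LYM⇒length≤ n lo m m+2lo≤n n≤ F uniq lym =
  *-cancelʳ-≤ (length F) (length G) ℓ (begin
    length F * ℓ
      ≡⟨ ∑-const F ℓ ⟨
    ∑[ B ← F ] ℓ
      -- With truncated subtraction, `w B + (ℓ ∸ w B)` is the maximum of `w B` and `ℓ`; on `G` it
      -- equals `ℓ`.
      ≤⟨ ∑-mono F (λ {B} _ → m≤n+m∸n ℓ (w B)) ⟩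
    ∑[ B ← F ] (w B + (ℓ ∸ w B))
      ≡⟨ ∑-distrib-+ F w (λ B → ℓ ∸ w B) ⟩
    ∑ F w + (∑[ B ← F ] (ℓ ∸ w B))
      ≤⟨ +-mono-≤ lym (∑-⊆ {ys = G} uniq (λ {B} _ → light⇒∈G B)) ⟩
    suc m * n ! + (∑[ B ← G ] (ℓ ∸ w B))
      ≡⟨ cong (_+ (∑[ B ← G ] (ℓ ∸ w B))) (∑-weight-sizeRange n lo (suc m) lo+1+m≤1+n) ⟨
    ∑ G w + (∑[ B ← G ] (ℓ ∸ w B))
      ≡⟨ ∑-distrib-+ G w (λ B → ℓ ∸ w B) ⟨
    ∑[ B ← G ] (w B + (ℓ ∸ w B))
      ≡⟨ ∑-cong G (λ {B} B∈G → m+[n∸m]≡n (∈G⇒light B B∈G)) ⟩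
    ∑[ B ← G ] ℓ
      ≡⟨ ∑-const G ℓ ⟩
    length G * ℓ ∎)
  where
  open ≤-Reasoning
  instance _ = lo !* (n ∸ lo) !≢0
  G = sizeRange n lo (suc m)
  ℓ = weight n lo

  w : Subset n → ℕ
  w B = weight n ∣ B ∣

  2lo≤n : lo + lo ≤ n
  2lo≤n = m+n≤o⇒n≤o m m+2lo≤n

  lo≤n : lo ≤ n
  lo≤n = m+n≤o⇒m≤o lo 2lo≤n

  lo≤n∸lo : lo ≤ n ∸ lo
  lo≤n∸lo = m+n≤o⇒m≤o∸n lo 2lo≤n

  lo+m+lo≤n : lo + m + lo ≤ n
  lo+m+lo≤n = subst (_≤ n) (reorder m lo) m+2lo≤n
    where
    reorder : ∀ a b → a + (b + b) ≡ b + a + b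
    reorder = solve-∀

  lo+1+m≤1+n : lo + suc m ≤ suc n
  lo+1+m≤1+n = subst (_≤ suc n) (sym (+-suc lo m)) (s≤s (m+n≤o⇒m≤o (lo + m) lo+m+lo≤n))

  ∈G⇒light : ∀ B → B ∈ G → w B ≤ ℓ
  ∈G⇒light B B∈G with ∈-sizeRange⁻ n lo (suc m) B∈G
  ... | lo≤ , <lo+1+m = weight-antitone lo≤ (m+n≤o⇒m≤o∸n lo (begin
    lo + ∣ B ∣    ≤⟨ +-monoʳ-≤ lo (≤-pred (subst (∣ B ∣ <_) (+-suc lo m) <lo+1+m)) ⟩
    lo + (lo + m) ≡⟨ +-comm lo (lo + m) ⟩
    lo + m + lo   ≤⟨ lo+m+lo≤n ⟩
    n             ∎)) (∣p∣≤n B)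

  light⇒∈G : ∀ B → ℓ ∸ w B ≢ 0 → B ∈ G
  light⇒∈G B light with lo ≤? ∣ B ∣ | ∣ B ∣ <? lo + suc m
  ... | yes lo≤ | yes <lo+1+m = ∈-sizeRange⁺ n lo (suc m) lo≤ <lo+1+m
  ... | no  lo≰ | _ = contradiction (m≤n⇒m∸n≡0 (weight-antitone ∣B∣≤lo (≤-trans ∣B∣≤lo lo≤n∸lo) lo≤n)) light
    where
    ∣B∣≤lo : ∣ B ∣ ≤ lo
    ∣B∣≤lo = <⇒≤ (≰⇒> lo≰)
  -- Above the range the complement has size at most `lo`, and complements have equal weight.
  ... | yes lo≤ | no ≮lo+1+m = contradiction (m≤n⇒m∸n≡0 (begin
    ℓ                      ≤⟨ weight-antitone (m≤n+o⇒m∸n≤o n ∣ B ∣ (≤-trans n≤ (+-monoˡ-≤ lo (≮⇒≥ ≮lo+1+m))))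
                                              (∸-monoʳ-≤ n lo≤) lo≤n ⟩
    weight n (n ∸ ∣ B ∣)   ≡⟨ weight-sym (∣p∣≤n B) ⟩
    w B                    ∎)) light

-- The middle levels contain no configuration

-- The listed sets are distinct coatoms of `C` containing `A`, and `∑-coatoms-⊇` counts all of
-- these.
length≤rank : {A C : Subset n} {xs : Family n} → Unique xs →
              All (λ B → A ⊆ B × B ⊆ C × suc ∣ B ∣ ≡ ∣ C ∣) xs → A ⊆ C → length xs ≤ ∣ C ∣ ∸ ∣ A ∣
length≤rank {A = A} {C} {xs} uniq all A⊆C = begin
  length xs
    ≤⟨ length-⊆ {ys = filter (A ⊆?_) (coatoms C)} uniq (λ B∈ →
         let A⊆B , B⊆C , eq = All.lookup all B∈
         in  ∈-filter⁺ (A ⊆?_) (∈-coatoms B⊆C eq) A⊆B) ⟩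
  length (filter (A ⊆?_) (coatoms C))
    ≡⟨ ∑-one (filter (A ⊆?_) (coatoms C)) ⟨
  ∑[ B ← filter (A ⊆?_) (coatoms C) ] 1
    ≡⟨ ∑-filter (A ⊆?_) (coatoms C) (λ _ → 1) ⟩
  ∑[ B ← coatoms C ] ⟦ A ⊆? B ⟧ * 1
    ≡⟨ ∑-cong (coatoms C) (λ {B} _ → *-identityʳ ⟦ A ⊆? B ⟧) ⟩
  ∑[ B ← coatoms C ] ⟦ A ⊆? B ⟧
    ≡⟨ ∑-coatoms-⊇ A C ⟩
  ⟦ A ⊆? C ⟧ * (∣ C ∣ ∸ ∣ A ∣)
    ≡⟨ cong (_* (∣ C ∣ ∸ ∣ A ∣)) (⟦⟧-true {P = A ⊆ C} A⊆C (A ⊆? C)) ⟩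
  1 * (∣ C ∣ ∸ ∣ A ∣)
    ≡⟨ *-identityˡ (∣ C ∣ ∸ ∣ A ∣) ⟩
  ∣ C ∣ ∸ ∣ A ∣ ∎
  where open ≤-Reasoning

-- Complementation turns upper covers of `A` inside `C` into coatoms of `∁ A` containing `∁ C`.
length≤rank′ : {A C : Subset n} {xs : Family n} → Unique xs →
               All (λ B → A ⊆ B × B ⊆ C × suc ∣ A ∣ ≡ ∣ B ∣) xs → A ⊆ C → length xs ≤ ∣ C ∣ ∸ ∣ A ∣
length≤rank′ {n = n} {A = A} {C} {xs} uniq all A⊆C = subst₂ _≤_ (length-map ∁ xs) (∣∁∣∸∣∁∣ A C)
  (length≤rank {A = ∁ C} {∁ A} (Unique.map⁺ ∁-injective uniq) (All.map⁺ (All.tabulate λ B∈ → dual (All.lookup all B∈)))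
    (p⊆q⇒∁p⊇∁q A⊆C))
  where
  cosize : ∀ B → suc ∣ A ∣ ≡ ∣ B ∣ → suc ∣ ∁ B ∣ ≡ ∣ ∁ A ∣
  cosize B eq = begin
    suc ∣ ∁ B ∣         ≡⟨ cong suc (∣∁p∣≡n∸∣p∣ B) ⟩
    suc (n ∸ ∣ B ∣)     ≡⟨ +-∸-assoc 1 (∣p∣≤n B) ⟨
    suc n ∸ ∣ B ∣       ≡⟨ cong (suc n ∸_) eq ⟨
    suc n ∸ suc ∣ A ∣   ≡⟨ ∣∁p∣≡n∸∣p∣ A ⟨
    ∣ ∁ A ∣             ∎
    where open ≡-Reasoning

  dual : ∀ {B} → A ⊆ B × B ⊆ C × suc ∣ A ∣ ≡ ∣ B ∣ → ∁ C ⊆ ∁ B × ∁ B ⊆ ∁ A × suc ∣ ∁ B ∣ ≡ ∣ ∁ A ∣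
  dual {B} (A⊆B , B⊆C , eq) = p⊆q⇒∁p⊇∁q B⊆C , p⊆q⇒∁p⊇∁q A⊆B , cosize B eq

¬Config-sizeRange : ∀ n lo → ¬ Config (sizeRange n lo 4)
¬Config-sizeRange n lo (A , B₁ , B₂ , B₃ , B₄ , C , (A∈ , _ , _ , _ , _ , C∈)
    , (A⊂B₁ , A⊂B₂ , A⊂B₃ , A⊂B₄) , (B₁⊂C , B₂⊂C , B₃⊂C , B₄⊂C)
    , (B₁≡B₂ , B₁≡B₃ , B₁≡B₄) , (B₁≢B₂ , B₁≢B₃ , B₁≢B₄ , B₂≢B₃ , B₂≢B₄ , B₃≢B₄)) = case cover of λ where
    (inj₁ eq) → <⇒≱ C∸A<4 (length≤rank′ uniq
      ( (proj₁ A⊂B₁ , proj₁ B₁⊂C , eq)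
      ∷ (proj₁ A⊂B₂ , proj₁ B₂⊂C , trans eq B₁≡B₂)
      ∷ (proj₁ A⊂B₃ , proj₁ B₃⊂C , trans eq B₁≡B₃)
      ∷ (proj₁ A⊂B₄ , proj₁ B₄⊂C , trans eq B₁≡B₄) ∷ []) A⊆C)
    (inj₂ eq) → <⇒≱ C∸A<4 (length≤rank uniq
      ( (proj₁ A⊂B₁ , proj₁ B₁⊂C , eq)
      ∷ (proj₁ A⊂B₂ , proj₁ B₂⊂C , trans (cong suc (sym B₁≡B₂)) eq)
      ∷ (proj₁ A⊂B₃ , proj₁ B₃⊂C , trans (cong suc (sym B₁≡B₃)) eq)
      ∷ (proj₁ A⊂B₄ , proj₁ B₄⊂C , trans (cong suc (sym B₁≡B₄)) eq) ∷ []) A⊆C)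
  where
  uniq : Unique (B₁ ∷ B₂ ∷ B₃ ∷ B₄ ∷ [])
  uniq = (B₁≢B₂ ∷ B₁≢B₃ ∷ B₁≢B₄ ∷ []) ∷ (B₂≢B₃ ∷ B₂≢B₄ ∷ []) ∷ (B₃≢B₄ ∷ []) ∷ [] ∷ []

  A⊆C : A ⊆ C
  A⊆C = ⊆-trans (proj₁ A⊂B₁) (proj₁ B₁⊂C)

  C<A+4 : ∣ C ∣ < ∣ A ∣ + 4
  C<A+4 = <-≤-trans (proj₂ (∈-sizeRange⁻ n lo 4 C∈)) (+-monoˡ-≤ 4 (proj₁ (∈-sizeRange⁻ n lo 4 A∈)))

  C∸A<4 : ∣ C ∣ ∸ ∣ A ∣ < 4
  C∸A<4 = s≤s (m≤n+o⇒m∸n≤o ∣ C ∣ ∣ A ∣ (≤-pred (subst (suc ∣ C ∣ ≤_) (+-suc ∣ A ∣ 3) C<A+4)))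

  -- `B₁` decides for all four sets, as their sizes agree.
  cover : suc ∣ A ∣ ≡ ∣ B₁ ∣ ⊎ suc ∣ B₁ ∣ ≡ ∣ C ∣
  cover with m≤n⇒m<n∨m≡n (p⊂q⇒∣p∣<∣q∣ A⊂B₁) | m≤n⇒m<n∨m≡n (p⊂q⇒∣p∣<∣q∣ B₁⊂C)
  ... | inj₂ eq | _       = inj₁ eq
  ... | inj₁ _  | inj₂ eq = inj₂ eq
  -- Gaps of two on both sides would put `C` four levels above `A`.
  ... | inj₁ A+2≤B | inj₁ B+2≤C = contradiction C<A+4
    (≤⇒≯ (≤-trans (≤-reflexive (+-comm ∣ A ∣ 4)) (≤-trans (s≤s (s≤s A+2≤B)) B+2≤C)))

-- The range has exactly four levels, and the two inequalities place it centrally enough for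
-- `LYM⇒length≤` with `m = 3`. At `n = 2` the first equation would fail, the limits being 0 and 3.
middle-bounds : ∀ n → 3 ≤ n → let lo = ⌈ (n ∸ 4) /2⌉ in
                ⌈ (n + 4) /2⌉ ≡ lo + 4 × 3 + (lo + lo) ≤ n × n ≤ lo + 4 + lo
middle-bounds 1 (s≤s ())
middle-bounds 2 (s≤s (s≤s ()))
-- Here `n ∸ 4` truncates to 0, and the four levels are all sizes 0 to 3.
middle-bounds 3 _ = refl , ≤-refl , n≤1+n 3
middle-bounds (suc (suc (suc (suc m)))) _ =
    trans (cong (λ k → ⌈ (4 + k) /2⌉) (+-comm m 4)) (+-comm 4 ⌈ m /2⌉)
  , +-monoʳ-≤ 3 (begin
      -- By definition `⌈ m /2⌉` is `⌊ suc m /2⌋`, so its double is at most `suc m`.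
      ⌈ m /2⌉ + ⌈ m /2⌉        ≤⟨ +-monoʳ-≤ ⌈ m /2⌉ (⌊n/2⌋≤⌈n/2⌉ (suc m)) ⟩
      ⌊ suc m /2⌋ + ⌈ suc m /2⌉ ≡⟨ ⌊n/2⌋+⌈n/2⌉≡n (suc m) ⟩
      suc m                    ∎)
  , (begin
      4 + m                        ≡⟨ cong (4 +_) (⌊n/2⌋+⌈n/2⌉≡n m) ⟨
      4 + (⌊ m /2⌋ + ⌈ m /2⌉)      ≤⟨ +-monoʳ-≤ 4 (+-monoˡ-≤ ⌈ m /2⌉ (⌊n/2⌋≤⌈n/2⌉ m)) ⟩
      4 + (⌈ m /2⌉ + ⌈ m /2⌉)      ≡⟨ +-assoc 4 ⌈ m /2⌉ ⌈ m /2⌉ ⟨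
      4 + ⌈ m /2⌉ + ⌈ m /2⌉        ≡⟨ cong (_+ ⌈ m /2⌉) (+-comm 4 ⌈ m /2⌉) ⟩
      ⌈ m /2⌉ + 4 + ⌈ m /2⌉        ∎)
  where open ≤-Reasoning

theorem2p23 : (n : ℕ) → 3 ≤ n →
    ((F : Family n) → Unique F → ¬ Config F → length F ≤ Σ n 4)
    × (Σ[ F ∈ Family n ] Unique F × (∀ S → S ∈ F → InMiddleLevels n 4 S)
    × (∀ S → InMiddleLevels n 4 S → S ∈ F)
    × length F ≡ Σ n 4 × ¬ Config F)
theorem2p23 n 3≤n with middle-bounds n 3≤n
... | hi≡lo+4 , 3+2lo≤n , n≤lo+4+lo =
    (λ F uniq ¬config → subst (length F ≤_) length-G
       (LYM⇒length≤ n lo 3 3+2lo≤n n≤lo+4+lo F uniq (LYM-by-intervals F uniq 4 (through≤4! F uniq ¬config))))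
  , G , sizeRange-unique n lo 4
  , (λ S S∈G → subst (λ hi → lo ≤ ∣ S ∣ × ∣ S ∣ < hi) (sym hi≡lo+4) (∈-sizeRange⁻ n lo 4 S∈G))
  , (λ S (lo≤ , <hi) → ∈-sizeRange⁺ n lo 4 lo≤ (subst (∣ S ∣ <_) hi≡lo+4 <hi))
  , length-G
  , ¬Config-sizeRange n lo
  where
  lo = ⌈ (n ∸ 4) /2⌉
  G = sizeRange n lo 4

  length-G : length G ≡ Σ n 4
  length-G = trans (length-sizeRange n lo 4)
    -- The number of terms in `sumRange` is upper limit minus `lo`, which is 4.
    (cong (λ k → ∑[ j ← upTo k ] n choose (lo + j))
          (sym (trans (cong (_∸ lo) hi≡lo+4) (m+n∸m≡n lo 4))))
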